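{- Let $n\ge1$ be an integer, let $c\in\mathbb{R}^n$ and let $\rho$ be a real number with $0<\rho\le n$. Let $$B_\rho:=\{j\in\mathbb{Z},\ j\ge 0:\ D_c(\tau)>\rho\ \text{ for all } \tau\in I_j\}.$$ Then $$|B_\rho|\ \le\ n\log_2(n/\rho)$$ (in particular, $B_\rho$ is finite).
   Context: For integers $j\ge0$, $I_j:=[2^{ -j-1},2^{ -j}]\subseteq\mathbb{R}$. For $c\in\mathbb{R}^n$ and $\tau\in\mathbb{R}$, $D_c(\tau):=\min_{z\in\mathbb{Z}^n}\lVert\tau c-z\rVert_1$ is the $\ell_1$-distance of $\tau c$ to $\mathbb{Z}^n$. -}

module Defs where

open import Data.Nat.Base as ℕ using (ℕ; zero; suc)
import Data.Nat.Properties as ℕ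
open import Data.Integer.Base as ℤ using (ℤ; +_; -[1+_])
open import Data.Rational.Base as ℚ using (ℚ; 0ℚ; 1ℚ; ½)
import Data.Rational.Properties as ℚ
open import Data.Rational.Solver using (module +-*-Solver)
open import Data.List.Base using (List; length)
open import Data.List.Membership.Propositional using (_∈_)
open import Data.List.Relation.Unary.All using (All)
open import Data.List.Relation.Unary.Unique.Propositional using (Unique)
open import Data.Product.Base using (Σ; ∃; _×_; _,_; proj₁; proj₂)
open import Data.Sum.Base using (inj₁; inj₂)
open import Data.Vec.Functional using (Vector; foldr)
open import Function.Bundles using (_⇔_)
open import Relation.Binary.PropositionalEquality
open import Relation.Nullary using (¬_)

∣p-q∣≡∣q-p∣ : ∀ p q → ℚ.∣ p ℚ.- q ∣ ≡ ℚ.∣ q ℚ.- p ∣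
∣p-q∣≡∣q-p∣ p q = trans (sym (ℚ.∣-p∣≡∣p∣ (p ℚ.- q))) (cong ℚ.∣_∣ eq)
  where
  open +-*-Solver
  eq : ℚ.- (p ℚ.- q) ≡ q ℚ.- p
  eq = solve 2 (λ a b → :- (a :- b) := b :- a) refl p q

∣p∣≤∣q∣+∣p-q∣ : ∀ p q → ℚ.∣ p ∣ ℚ.≤ ℚ.∣ q ∣ ℚ.+ ℚ.∣ p ℚ.- q ∣
∣p∣≤∣q∣+∣p-q∣ p q =
  subst (λ z → ℚ.∣ z ∣ ℚ.≤ ℚ.∣ q ∣ ℚ.+ ℚ.∣ p ℚ.- q ∣) eq
    (ℚ.∣p+q∣≤∣p∣+∣q∣ q (p ℚ.- q))
  where
  open +-*-Solver
  eq : q ℚ.+ (p ℚ.- q) ≡ p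
  eq = solve 2 (λ a b → b :+ (a :- b) := a) refl p q

p≤q+r⇒p-q≤r : ∀ {p q r} → p ℚ.≤ q ℚ.+ r → p ℚ.- q ℚ.≤ r
p≤q+r⇒p-q≤r {p} {q} {r} h =
  subst (p ℚ.- q ℚ.≤_) eq (ℚ.+-monoˡ-≤ (ℚ.- q) h)
  where
  open +-*-Solver
  eq : (q ℚ.+ r) ℚ.- q ≡ r
  eq = solve 2 (λ a b → (a :+ b) :- a := b) refl q r

∣∣p∣-∣q∣∣≤∣p-q∣ : ∀ p q → ℚ.∣ ℚ.∣ p ∣ ℚ.- ℚ.∣ q ∣ ∣ ℚ.≤ ℚ.∣ p ℚ.- q ∣
∣∣p∣-∣q∣∣≤∣p-q∣ p q with ℚ.∣p∣≡p∨∣p∣≡-p (ℚ.∣ p ∣ ℚ.- ℚ.∣ q ∣)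
... | inj₁ e = subst (ℚ._≤ ℚ.∣ p ℚ.- q ∣) (sym e) (p≤q+r⇒p-q≤r (∣p∣≤∣q∣+∣p-q∣ p q))
... | inj₂ e = subst (ℚ._≤ ℚ.∣ p ℚ.- q ∣) (sym (trans e eq))
    (p≤q+r⇒p-q≤r (subst (λ z → ℚ.∣ q ∣ ℚ.≤ ℚ.∣ p ∣ ℚ.+ z) (∣p-q∣≡∣q-p∣ q p)
      (∣p∣≤∣q∣+∣p-q∣ q p)))
  where
  open +-*-Solver
  eq : ℚ.- (ℚ.∣ p ∣ ℚ.- ℚ.∣ q ∣) ≡ ℚ.∣ q ∣ ℚ.- ℚ.∣ p ∣
  eq = solve 2 (λ a b → :- (a :- b) := b :- a) refl ℚ.∣ p ∣ ℚ.∣ q ∣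

pos-* : ∀ {p q} → 0ℚ ℚ.< p → 0ℚ ℚ.< q → 0ℚ ℚ.< p ℚ.* q
pos-* {p} {q} 0<p 0<q =
  ℚ.positive⁻¹ (p ℚ.* q) {{ℚ.pos*pos⇒pos p {{ℚ.positive 0<p}} q {{ℚ.positive 0<q}}}}

0<½ : 0ℚ ℚ.< ½
0<½ = ℚ.positive⁻¹ ½

recip : ∀ q → 0ℚ ℚ.< q → ℚ
recip q 0<q = ℚ.1/_ q {{ℚ.>-nonZero 0<q}}

recip-pos : ∀ q (0<q : 0ℚ ℚ.< q) → 0ℚ ℚ.< recip q 0<q
recip-pos q 0<q = ℚ.positive⁻¹ _ {{ℚ.1/pos⇒pos q {{ℚ.positive 0<q}}}}

*-recip : ∀ q (0<q : 0ℚ ℚ.< q) → q ℚ.* recip q 0<q ≡ 1ℚ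
*-recip q 0<q = ℚ.*-inverseʳ q {{ℚ.>-nonZero 0<q}}

half+half : ∀ p → ½ ℚ.* p ℚ.+ ½ ℚ.* p ≡ p
half+half p = trans (sym (ℚ.*-distribʳ-+ p ½ ½)) (ℚ.*-identityˡ p)

------------------------------------------------------------------------
-- Real numbers as Cauchy sequences of rationals

record ℝ : Set where
  constructor mkℝ
  field
    seq    : ℕ → ℚ
    cauchy : ∀ ε → 0ℚ ℚ.< ε →
             ∃ λ N → ∀ m n → N ℕ.≤ m → N ℕ.≤ n → ℚ.∣ seq m ℚ.- seq n ∣ ℚ.< ε

open ℝ public

infix 4 _<_ _≤_ _≈_

-- Distinct sequences may represent the same real: equality of reals is _≈_,
-- not _≡_.
_<_ _≤_ _≈_ : ℝ → ℝ → Set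
x < y = ∃ λ ε → 0ℚ ℚ.< ε × ∃ λ N → ∀ n → N ℕ.≤ n → seq x n ℚ.+ ε ℚ.≤ seq y n
x ≤ y = ¬ (y < x)
x ≈ y = x ≤ y × y ≤ x

fromℚ : ℚ → ℝ
fromℚ q = mkℝ (λ _ → q) λ ε 0<ε → 0 , λ _ _ _ _ →
  subst (ℚ._< ε) (sym (cong ℚ.∣_∣ (ℚ.+-inverseʳ q))) 0<ε

fromℤ : ℤ → ℝ
fromℤ i = fromℚ (i ℚ./ 1)

fromℕ : ℕ → ℝ
fromℕ n = fromℤ (+ n)

0ℝ 1ℝ : ℝ
0ℝ = fromℚ 0ℚ
1ℝ = fromℚ 1ℚ

infix  8 -_
infixl 7 _*_
infixl 6 _+_ _-_

_+_ : ℝ → ℝ → ℝ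
x + y = mkℝ (λ n → seq x n ℚ.+ seq y n) λ ε 0<ε →
  let δ       = ½ ℚ.* ε
      M , hM  = cauchy x δ (pos-* 0<½ 0<ε)
      N , hN  = cauchy y δ (pos-* 0<½ 0<ε)
  in M ℕ.⊔ N , λ m n hm hn →
    let a = seq x m ; b = seq y m ; c = seq x n ; d = seq y n
        open ℚ.≤-Reasoning
    in begin-strict
      ℚ.∣ (a ℚ.+ b) ℚ.- (c ℚ.+ d) ∣          ≡⟨ cong ℚ.∣_∣ (rearrange a b c d) ⟩
      ℚ.∣ (a ℚ.- c) ℚ.+ (b ℚ.- d) ∣          ≤⟨ ℚ.∣p+q∣≤∣p∣+∣q∣ (a ℚ.- c) (b ℚ.- d) ⟩
      ℚ.∣ a ℚ.- c ∣ ℚ.+ ℚ.∣ b ℚ.- d ∣        <⟨ ℚ.+-mono-<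
          (hM m n (ℕ.≤-trans (ℕ.m≤m⊔n M N) hm) (ℕ.≤-trans (ℕ.m≤m⊔n M N) hn))
          (hN m n (ℕ.≤-trans (ℕ.m≤n⊔m M N) hm) (ℕ.≤-trans (ℕ.m≤n⊔m M N) hn)) ⟩
      δ ℚ.+ δ                                ≡⟨ half+half ε ⟩
      ε                                      ∎
  where
  open +-*-Solver
  rearrange : ∀ a b c d → (a ℚ.+ b) ℚ.- (c ℚ.+ d) ≡ (a ℚ.- c) ℚ.+ (b ℚ.- d)
  rearrange = solve 4 (λ a b c d → (a :+ b) :- (c :+ d) := (a :- c) :+ (b :- d)) refl

-_ : ℝ → ℝ
- x = mkℝ (λ n → ℚ.- seq x n) λ ε 0<ε →
  let N , hN = cauchy x ε 0<ε in N , λ m n hm hn →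
    subst (ℚ._< ε) (trans (∣p-q∣≡∣q-p∣ (seq x m) (seq x n))
                     (cong ℚ.∣_∣ (rearrange (seq x m) (seq x n)))) (hN m n hm hn)
  where
  open +-*-Solver
  rearrange : ∀ a b → b ℚ.- a ≡ ℚ.- a ℚ.- ℚ.- b
  rearrange = solve 2 (λ a b → b :- a := :- a :- :- b) refl

_-_ : ℝ → ℝ → ℝ
x - y = x + - y

∣_∣ : ℝ → ℝ
∣ x ∣ = mkℝ (λ n → ℚ.∣ seq x n ∣) λ ε 0<ε →
  let N , hN = cauchy x ε 0<ε in N , λ m n hm hn →
    ℚ.≤-<-trans (∣∣p∣-∣q∣∣≤∣p-q∣ (seq x m) (seq x n)) (hN m n hm hn)

bounded : ∀ x → ∃ λ K → 0ℚ ℚ.< K × ∃ λ N → ∀ n → N ℕ.≤ n → ℚ.∣ seq x n ∣ ℚ.≤ K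
bounded x =
  let N , hN = cauchy x 1ℚ (ℚ.positive⁻¹ 1ℚ)
      a      = seq x N
  in ℚ.∣ a ∣ ℚ.+ 1ℚ
   , ℚ.+-mono-≤-< (ℚ.0≤∣p∣ a) (ℚ.positive⁻¹ 1ℚ)
   , N
   , λ n hn → ℚ.≤-trans (∣p∣≤∣q∣+∣p-q∣ (seq x n) a)
       (ℚ.+-monoʳ-≤ ℚ.∣ a ∣ (ℚ.<⇒≤ (hN n N hn ℕ.≤-refl)))

_*_ : ℝ → ℝ → ℝ
x * y = mkℝ (λ n → seq x n ℚ.* seq y n) λ ε 0<ε →
  let K₁ , 0<K₁ , N₁ , h₁ = bounded x
      K₂ , 0<K₂ , N₂ , h₂ = bounded y
      K    = K₁ ℚ.+ K₂
      0<K  = ℚ.+-mono-< 0<K₁ 0<K₂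
      δ    = (½ ℚ.* ε) ℚ.* recip K 0<K
      0<δ  = pos-* (pos-* 0<½ 0<ε) (recip-pos K 0<K)
      N₃ , h₃ = cauchy x δ 0<δ
      N₄ , h₄ = cauchy y δ 0<δ
      N    = (N₁ ℕ.⊔ N₂) ℕ.⊔ (N₃ ℕ.⊔ N₄)
      N₁≤N = ℕ.≤-trans (ℕ.m≤m⊔n N₁ N₂) (ℕ.m≤m⊔n (N₁ ℕ.⊔ N₂) (N₃ ℕ.⊔ N₄))
      N₂≤N = ℕ.≤-trans (ℕ.m≤n⊔m N₁ N₂) (ℕ.m≤m⊔n (N₁ ℕ.⊔ N₂) (N₃ ℕ.⊔ N₄))
      N₃≤N = ℕ.≤-trans (ℕ.m≤m⊔n N₃ N₄) (ℕ.m≤n⊔m (N₁ ℕ.⊔ N₂) (N₃ ℕ.⊔ N₄))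
      N₄≤N = ℕ.≤-trans (ℕ.m≤n⊔m N₃ N₄) (ℕ.m≤n⊔m (N₁ ℕ.⊔ N₂) (N₃ ℕ.⊔ N₄))
  in N , λ m n hm hn →
    let a = seq x m ; b = seq y m ; c = seq x n ; d = seq y n
        ∣a∣≤K = ℚ.≤-trans (h₁ m (ℕ.≤-trans N₁≤N hm)) (p≤p+q 0<K₂)
        ∣d∣≤K = ℚ.≤-trans (h₂ n (ℕ.≤-trans N₂≤N hn)) (q≤p+q 0<K₁)
        open ℚ.≤-Reasoning
    in begin-strict
      ℚ.∣ a ℚ.* b ℚ.- c ℚ.* d ∣
        ≡⟨ cong ℚ.∣_∣ (rearrange a b c d) ⟩
      ℚ.∣ a ℚ.* (b ℚ.- d) ℚ.+ d ℚ.* (a ℚ.- c) ∣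
        ≤⟨ ℚ.∣p+q∣≤∣p∣+∣q∣ (a ℚ.* (b ℚ.- d)) (d ℚ.* (a ℚ.- c)) ⟩
      ℚ.∣ a ℚ.* (b ℚ.- d) ∣ ℚ.+ ℚ.∣ d ℚ.* (a ℚ.- c) ∣
        <⟨ ℚ.+-mono-<
             (small 0<K ∣a∣≤K (h₄ m n (ℕ.≤-trans N₄≤N hm) (ℕ.≤-trans N₄≤N hn)))
             (small 0<K ∣d∣≤K (h₃ m n (ℕ.≤-trans N₃≤N hm) (ℕ.≤-trans N₃≤N hn))) ⟩
      K ℚ.* δ ℚ.+ K ℚ.* δ
        ≡⟨ cong₂ ℚ._+_ (cancel ε K 0<K) (cancel ε K 0<K) ⟩
      ½ ℚ.* ε ℚ.+ ½ ℚ.* ε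
        ≡⟨ half+half ε ⟩
      ε ∎
  where
  rearrange : ∀ a b c d →
    a ℚ.* b ℚ.- c ℚ.* d ≡ a ℚ.* (b ℚ.- d) ℚ.+ d ℚ.* (a ℚ.- c)
  rearrange = solve 4 (λ a b c d →
    a :* b :- c :* d := a :* (b :- d) :+ d :* (a :- c)) refl
    where open +-*-Solver

  p≤p+q : ∀ {p q} → 0ℚ ℚ.< q → p ℚ.≤ p ℚ.+ q
  p≤p+q {p} {q} 0<q = subst (ℚ._≤ p ℚ.+ q) (ℚ.+-identityʳ p) (ℚ.+-monoʳ-≤ p (ℚ.<⇒≤ 0<q))

  q≤p+q : ∀ {p q} → 0ℚ ℚ.< p → q ℚ.≤ p ℚ.+ q
  q≤p+q {p} {q} 0<p = subst (ℚ._≤ p ℚ.+ q) (ℚ.+-identityˡ q) (ℚ.+-monoˡ-≤ q (ℚ.<⇒≤ 0<p))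

  small : ∀ {K δ u v} → 0ℚ ℚ.< K → ℚ.∣ u ∣ ℚ.≤ K → ℚ.∣ v ∣ ℚ.< δ → ℚ.∣ u ℚ.* v ∣ ℚ.< K ℚ.* δ
  small {K} {δ} {u} {v} 0<K hu hv = begin-strict
    ℚ.∣ u ℚ.* v ∣          ≡⟨ ℚ.∣p*q∣≡∣p∣*∣q∣ u v ⟩
    ℚ.∣ u ∣ ℚ.* ℚ.∣ v ∣    ≤⟨ ℚ.*-monoʳ-≤-nonNeg ℚ.∣ v ∣ {{ℚ.∣-∣-nonNeg v}} hu ⟩
    K ℚ.* ℚ.∣ v ∣          <⟨ ℚ.*-monoʳ-<-pos K {{ℚ.positive 0<K}} hv ⟩
    K ℚ.* δ                ∎
    where open ℚ.≤-Reasoning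

  cancel : ∀ ε K 0<K → K ℚ.* ((½ ℚ.* ε) ℚ.* recip K 0<K) ≡ ½ ℚ.* ε
  cancel ε K 0<K = trans (comm K (½ ℚ.* ε) (recip K 0<K))
    (trans (cong ((½ ℚ.* ε) ℚ.*_) (*-recip K 0<K)) (ℚ.*-identityʳ (½ ℚ.* ε)))
    where
    open +-*-Solver
    comm : ∀ k h r → k ℚ.* (h ℚ.* r) ≡ h ℚ.* (k ℚ.* r)
    comm = solve 3 (λ k h r → k :* (h :* r) := h :* (k :* r)) refl

-- Truncating below at δ changes only the finitely many terms of x that precede
-- the index witnessing 0 < x.
reciprocal : (x : ℝ) → 0ℝ < x → ℝ
reciprocal x (δ , 0<δ , N , δ≤x) =
  mkℝ (λ n → recip (δ ℚ.⊔ seq x n) (0<t n)) λ ε 0<ε →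
  let η      = (δ ℚ.* δ) ℚ.* ε
      M , hM = cauchy x η (pos-* (pos-* 0<δ 0<δ) 0<ε)
  in M ℕ.⊔ N , λ m n hm hn →
    let a = t m ; b = t n ; u = recip a (0<t m) ; v = recip b (0<t n)
        hx : ℚ.∣ b ℚ.- a ∣ ℚ.< η
        hx = subst₂ (λ p q → ℚ.∣ p ℚ.- q ∣ ℚ.< η)
               (sym (t≡x n (ℕ.≤-trans (ℕ.m≤n⊔m M N) hn)))
               (sym (t≡x m (ℕ.≤-trans (ℕ.m≤n⊔m M N) hm)))
               (hM n m (ℕ.≤-trans (ℕ.m≤m⊔n M N) hn) (ℕ.≤-trans (ℕ.m≤m⊔n M N) hm))
        0<ab = pos-* (0<t m) (0<t n)
        open ℚ.≤-Reasoning
    in ℚ.*-cancelˡ-<-nonNeg (a ℚ.* b) {{ℚ.pos⇒nonNeg (a ℚ.* b) {{ℚ.positive 0<ab}}}}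
      (begin-strict
        (a ℚ.* b) ℚ.* ℚ.∣ u ℚ.- v ∣
          ≡⟨ cong (ℚ._* ℚ.∣ u ℚ.- v ∣) (ℚ.0≤p⇒∣p∣≡p (ℚ.<⇒≤ 0<ab)) ⟨
        ℚ.∣ a ℚ.* b ∣ ℚ.* ℚ.∣ u ℚ.- v ∣
          ≡⟨ ℚ.∣p*q∣≡∣p∣*∣q∣ (a ℚ.* b) (u ℚ.- v) ⟨
        ℚ.∣ (a ℚ.* b) ℚ.* (u ℚ.- v) ∣
          ≡⟨ cong ℚ.∣_∣ (rearrange a b u v) ⟩
        ℚ.∣ b ℚ.* (a ℚ.* u) ℚ.- a ℚ.* (b ℚ.* v) ∣
          ≡⟨ cong₂ (λ p q → ℚ.∣ b ℚ.* p ℚ.- a ℚ.* q ∣)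
               (*-recip a (0<t m)) (*-recip b (0<t n)) ⟩
        ℚ.∣ b ℚ.* 1ℚ ℚ.- a ℚ.* 1ℚ ∣
          ≡⟨ cong₂ (λ p q → ℚ.∣ p ℚ.- q ∣) (ℚ.*-identityʳ b) (ℚ.*-identityʳ a) ⟩
        ℚ.∣ b ℚ.- a ∣
          <⟨ hx ⟩
        (δ ℚ.* δ) ℚ.* ε
          ≤⟨ ℚ.*-monoʳ-≤-nonNeg ε {{nonNeg 0<ε}} (begin
               δ ℚ.* δ  ≤⟨ ℚ.*-monoˡ-≤-nonNeg δ {{nonNeg 0<δ}} (ℚ.p≤p⊔q δ (seq x n)) ⟩
               δ ℚ.* b  ≤⟨ ℚ.*-monoʳ-≤-nonNeg b {{nonNeg (0<t n)}} (ℚ.p≤p⊔q δ (seq x m)) ⟩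
               a ℚ.* b  ∎) ⟩
        (a ℚ.* b) ℚ.* ε
          ∎)
  where
  t : ℕ → ℚ
  t n = δ ℚ.⊔ seq x n

  0<t : ∀ n → 0ℚ ℚ.< t n
  0<t n = ℚ.<-≤-trans 0<δ (ℚ.p≤p⊔q δ (seq x n))

  t≡x : ∀ n → N ℕ.≤ n → t n ≡ seq x n
  t≡x n hn = ℚ.p≤q⇒p⊔q≡q (subst (ℚ._≤ seq x n) (ℚ.+-identityˡ δ) (δ≤x n hn))

  nonNeg : ∀ {p} → 0ℚ ℚ.< p → ℚ.NonNegative p
  nonNeg 0<p = ℚ.nonNegative (ℚ.<⇒≤ 0<p)

  rearrange : ∀ a b u v →
    (a ℚ.* b) ℚ.* (u ℚ.- v) ≡ b ℚ.* (a ℚ.* u) ℚ.- a ℚ.* (b ℚ.* v)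
  rearrange = solve 4 (λ a b u v →
    (a :* b) :* (u :- v) := b :* (a :* u) :- a :* (b :* v)) refl
    where open +-*-Solver

infixr 8 _^_

_^_ : ℝ → ℕ → ℝ
x ^ zero  = 1ℝ
x ^ suc n = x * x ^ n

------------------------------------------------------------------------
-- Powers of two and the binary logarithm

2^ : ℤ → ℚ
2^ (+ n)    = + (2 ℕ.^ n) ℚ./ 1
2^ -[1+ n ] = ℚ._/_ (+ 1) (2 ℕ.^ suc n) {{ℕ.m^n≢0 2 (suc n)}}

-- x = 2 ^ y for a real exponent y, the real power being squeezed between the
-- rational powers 2 ^ (p / q); these are compared with x through their q-th
-- powers, 2 ^ p against x ^ q.
IsPow₂ : ℝ → ℝ → Set
IsPow₂ y x =
  (∀ r → fromℚ r < y → fromℚ (2^ (ℚ.↥ r)) < x ^ ℚ.↧ₙ r) ×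
  (∀ r → y < fromℚ r → x ^ ℚ.↧ₙ r < fromℚ (2^ (ℚ.↥ r)))

IsLog₂ : ℝ → ℝ → Set
IsLog₂ x y = IsPow₂ y x

------------------------------------------------------------------------
-- Distance to the integer lattice

∥_∥₁ : ∀ {n} → Vector ℝ n → ℝ
∥ v ∥₁ = foldr (λ x s → ∣ x ∣ + s) 0ℝ v

IsMin : {A : Set} → (A → ℝ) → ℝ → Set
IsMin {A} f d = (Σ A λ a → f a ≈ d) × (∀ a → d ≤ f a)

-- d = D_c(τ).  The minimum is a relation rather than a function because locating
-- a nearest lattice point is not computable.
IsLatticeDist : ∀ {n} → Vector ℝ n → ℝ → ℝ → Set
IsLatticeDist {n} c τ d =
  IsMin {Vector ℤ n} (λ z → ∥ (λ i → τ * c i - fromℤ (z i)) ∥₁) d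

I : ℕ → ℝ → Set
I j τ = fromℚ (2^ (ℤ.- (+ suc j))) ≤ τ × τ ≤ fromℚ (2^ (ℤ.- (+ j)))

-- The minimum d always exists classically and is unique up to _≈_; quantifying
-- over it universally gives the constructively largest reading of the set.
B : ∀ {n} → Vector ℝ n → ℝ → ℕ → Set
B c ρ j = ∀ τ → I j τ → ∀ d → IsLatticeDist c τ d → ρ < d

------------------------------------------------------------------------
-- Size of a set of natural numbers

Enumerates : List ℕ → (ℕ → Set) → Set
Enumerates xs P = Unique xs × (∀ j → j ∈ xs ⇔ P j)

-- For P undecidable an enumeration cannot be computed from P, even when P is a
-- subset of a fixed finite set; hence the double negation.
Finite : (ℕ → Set) → Set
Finite P = ¬ ¬ ∃ λ xs → Enumerates xs P

-- Bounding all finite subsets bounds |P|, whether or not an enumeration of P is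
-- available.
CardAtMost : (ℕ → Set) → ℝ → Set
CardAtMost P b = ∀ xs → Unique xs → All P xs → fromℕ (length xs) ≤ b

{-# OPTIONS --safe #-}
module Submission where

-- Write s = ρ / n and let k be the number of elements of a finite part of B_ρ.  The
-- bound amounts to 2 ^ k * s ^ n ≤ 1, which is a density argument for the line
-- τ ↦ τ c in the torus ℝ ^ n / ℤ ^ n.
--
-- Consider the times at which a translate x + τ c of the line meets the cube [0, s) ^ n.
-- Two such times differ by some t for which t c is within s of an integer in every
-- coordinate, so that D_c(t) ≤ n s = ρ; hence t lies in no interval I_j with j ∈ B_ρ.
-- On the other hand the cube has volume s ^ n, so for some translate the set of these
-- times has density at least s ^ n in [0, 1].
--
-- A set S of times whose differences avoid [T, 2T] has in every window of length 2T at
-- most as many elements as it can have in a window of length T: if b is its first element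
-- in the window, S has no elements in [b + T, b + 2T].  Without this assumption doubling
-- the window at most doubles the count.  Running through the dyadic scales up to length 1,
-- each j ∈ B_ρ saves a factor of 2, and the density of S is at most 2 ^ - k (density).
--
-- The formal argument is finite.  Time runs through multiples of 2 ^ - N, c is replaced by
-- a rational approximation, and s by a rational slightly below ρ / n.  The translate is
-- found one coordinate at a time, by averaging over the finitely many rotations modulo a
-- common denominator (averaging, thin, return-times).  Together with density this gives
-- few-scales and, in terms of B, few-scales-B.
--
-- The logarithm of a positive real x is constructed from integers l_m such that
-- 2 ^ l_m ≤ x ^ (m + 1) ≤ 2 ^ (l_m + 3), as the limit of the fractions l_m / (m + 1).  A
-- strict inequality between integer exponents gains a factor of 2 between the powers, which
-- root-gap turns into the additive gap that the strict order of the reals asks for.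
--
-- The minimum in D_c is attained by rounding each coordinate (lattice-dist-exists), up to a
-- double negation, which is harmless since a contradiction is sought.  Finiteness follows
-- from the cardinality bound: a list that does not yet enumerate B can be prolonged.

open import Defs
open import Algebra.Bundles using (module CommutativeRing)
import Algebra.Properties.CommutativeSemiring.Exp as Exp
open import Data.Bool.Base using (Bool; true; false; _∧_; _∨_)
open import Data.Bool.Properties using (T-≡)
open import Data.Empty using (⊥; ⊥-elim)
open import Data.Fin.Base using (zero; suc)
open import Data.Integer.Base as ℤ using (ℤ; +_; -[1+_])
import Data.Integer.DivMod as ℤ
import Data.Integer.Properties as ℤ
open import Data.Integer.Solver using () renaming (module +-*-Solver to ℤ-Solver)
open import Data.List.Base using (List; []; _∷_; length)
open import Data.List.Membership.Propositional using (_∈_)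
open import Data.List.Relation.Unary.All as All using (All; []; _∷_)
open import Data.List.Relation.Unary.AllPairs using ([]; _∷_)
open import Data.List.Relation.Unary.Unique.Propositional using (Unique)
open import Data.Nat.Base as ℕ using (ℕ; zero; suc)
import Data.Nat.DivMod as ℕ
import Data.Nat.Properties as ℕ
open import Data.Nat.Solver using () renaming (module +-*-Solver to ℕ-Solver)
open import Data.List.Membership.DecPropositional ℕ._≟_ using (_∈?_)
open import Data.Product.Base using (Σ; ∃; _×_; _,_; proj₁; proj₂)
open import Data.Rational.Base as ℚ using (ℚ; 0ℚ; 1ℚ; ½)
import Data.Rational.Properties as ℚ
open import Data.Rational.Solver using (module +-*-Solver)
import Data.Rational.Unnormalised.Base as ℚᵘ
import Data.Rational.Unnormalised.Properties as ℚᵘ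
open import Data.Sum.Base using (_⊎_; inj₁; inj₂)
open import Data.Vec.Functional using (Vector; head; tail) renaming (_∷_ to _∷ᵛ_)
open import Function.Base using (_∘_)
open import Function.Bundles using (Equivalence; mk⇔)
open import Relation.Binary.Definitions using (tri<; tri≈; tri>)
open import Relation.Binary.PropositionalEquality hiding ([_])
open import Relation.Nullary using (¬_; Dec; yes; no)
open import Relation.Nullary.Decidable using (does; dec-true; dec-false; decidable-stable)

open Exp (CommutativeRing.commutativeSemiring ℚ.+-*-commutativeRing)
  using () renaming (_^_ to _^ᵠ_; ^-assocʳ to ^ᵠ-assocʳ; ^-distrib-* to ^ᵠ-distrib-*)

-- Inequalities between rationals

-- Transfers an inequality along an equality of differences, which the ring
-- solver can check.
≤-diff : ∀ {p q r s} → p ℚ.≤ q → q ℚ.- p ≡ s ℚ.- r → r ℚ.≤ s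
≤-diff {p} {q} {r} {s} p≤q eq =
  subst₂ ℚ._≤_ (ℚ.+-identityˡ r) (back s r)
    (ℚ.+-monoˡ-≤ r (subst (0ℚ ℚ.≤_) eq
      (subst (ℚ._≤ q ℚ.- p) (ℚ.+-inverseʳ p) (ℚ.+-monoˡ-≤ (ℚ.- p) p≤q))))
  where
  open +-*-Solver
  back : ∀ s r → (s ℚ.- r) ℚ.+ r ≡ s
  back = solve 2 (λ s r → (s :- r) :+ r := s) refl

<-diff : ∀ {p q r s} → p ℚ.< q → q ℚ.- p ≡ s ℚ.- r → r ℚ.< s
<-diff {p} {q} {r} {s} p<q eq =
  subst₂ ℚ._<_ (ℚ.+-identityˡ r) (back s r)
    (ℚ.+-monoˡ-< r (subst (0ℚ ℚ.<_) eq
      (subst (ℚ._< q ℚ.- p) (ℚ.+-inverseʳ p) (ℚ.+-monoˡ-< (ℚ.- p) p<q))))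
  where
  open +-*-Solver
  back : ∀ s r → (s ℚ.- r) ℚ.+ r ≡ s
  back = solve 2 (λ s r → (s :- r) :+ r := s) refl

*-mono-≤-nonNeg : ∀ {p q r s} → 0ℚ ℚ.≤ p → 0ℚ ℚ.≤ s → p ℚ.≤ q → r ℚ.≤ s → p ℚ.* r ℚ.≤ q ℚ.* s
*-mono-≤-nonNeg {p} {q} {r} {s} 0≤p 0≤s p≤q r≤s = ℚ.≤-trans
  (ℚ.*-monoˡ-≤-nonNeg p {{ℚ.nonNegative 0≤p}} r≤s)
  (ℚ.*-monoʳ-≤-nonNeg s {{ℚ.nonNegative 0≤s}} p≤q)

*-nonNeg : ∀ {p q} → 0ℚ ℚ.≤ p → 0ℚ ℚ.≤ q → 0ℚ ℚ.≤ p ℚ.* q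
*-nonNeg {p} {q} 0≤p 0≤q = ℚ.nonNegative⁻¹ _
  {{ℚ.nonNeg*nonNeg⇒nonNeg p {{ℚ.nonNegative 0≤p}} q {{ℚ.nonNegative 0≤q}}}}

*-monoˡ-≤ : ∀ {p q} r → 0ℚ ℚ.≤ r → p ℚ.≤ q → r ℚ.* p ℚ.≤ r ℚ.* q
*-monoˡ-≤ r 0≤r = ℚ.*-monoˡ-≤-nonNeg r {{ℚ.nonNegative 0≤r}}

*-monoʳ-≤ : ∀ {p q} r → 0ℚ ℚ.≤ r → p ℚ.≤ q → p ℚ.* r ℚ.≤ q ℚ.* r
*-monoʳ-≤ r 0≤r = ℚ.*-monoʳ-≤-nonNeg r {{ℚ.nonNegative 0≤r}}

*-monoˡ-< : ∀ {p q} r → 0ℚ ℚ.< r → p ℚ.< q → r ℚ.* p ℚ.< r ℚ.* q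
*-monoˡ-< r 0<r = ℚ.*-monoʳ-<-pos r {{ℚ.positive 0<r}}

*-cancelʳ-≤ : ∀ {p q} r → 0ℚ ℚ.< r → p ℚ.* r ℚ.≤ q ℚ.* r → p ℚ.≤ q
*-cancelʳ-≤ r 0<r = ℚ.*-cancelʳ-≤-pos r {{ℚ.positive 0<r}}

*-cancelʳ-< : ∀ {p q} r → 0ℚ ℚ.< r → p ℚ.* r ℚ.< q ℚ.* r → p ℚ.< q
*-cancelʳ-< r 0<r = ℚ.*-cancelʳ-<-nonNeg r {{ℚ.pos⇒nonNeg r {{ℚ.positive 0<r}}}}

∣p∣≤q : ∀ {p q} → p ℚ.≤ q → ℚ.- p ℚ.≤ q → ℚ.∣ p ∣ ℚ.≤ q
∣p∣≤q {p} p≤q -p≤q with ℚ.∣p∣≡p∨∣p∣≡-p p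
... | inj₁ eq = subst (ℚ._≤ _) (sym eq) p≤q
... | inj₂ eq = subst (ℚ._≤ _) (sym eq) -p≤q

∣p∣<q : ∀ {p q} → p ℚ.< q → ℚ.- p ℚ.< q → ℚ.∣ p ∣ ℚ.< q
∣p∣<q {p} p<q -p<q with ℚ.∣p∣≡p∨∣p∣≡-p p
... | inj₁ eq = subst (ℚ._< _) (sym eq) p<q
... | inj₂ eq = subst (ℚ._< _) (sym eq) -p<q

p≤∣p∣ : ∀ p → p ℚ.≤ ℚ.∣ p ∣
p≤∣p∣ p with ℚ.≤-total 0ℚ p
... | inj₁ 0≤p = ℚ.≤-reflexive (sym (ℚ.0≤p⇒∣p∣≡p 0≤p))
... | inj₂ p≤0 = ℚ.≤-trans p≤0 (ℚ.0≤∣p∣ p)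

-- Integers and naturals as rationals

opaque
  -- The embedding of the integers; opaque, so that a rational ι i is never unfolded
  -- into its normalised numerator and denominator.
  ι : ℤ → ℚ
  ι i = i ℚ./ 1

ιₙ : ℕ → ℚ
ιₙ n = ι (+ n)

opaque
  unfolding ι

  ι≡/1 : ∀ i → ι i ≡ i ℚ./ 1
  ι≡/1 i = refl

  ι0≡0 : ι (+ 0) ≡ 0ℚ
  ι0≡0 = refl

  ι1≡1 : ι (+ 1) ≡ 1ℚ
  ι1≡1 = refl

  ι≃ : ∀ i → ℚ.toℚᵘ (ι i) ℚᵘ.≃ ℚᵘ.mkℚᵘ i 0
  ι≃ i = ℚ.toℚᵘ-fromℚᵘ (ℚᵘ.mkℚᵘ i 0)

  ι-+ : ∀ i j → ι (i ℤ.+ j) ≡ ι i ℚ.+ ι j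
  ι-+ i j = ℚ.toℚᵘ-injective (begin
    ℚ.toℚᵘ (ι (i ℤ.+ j))                    ≈⟨ ι≃ (i ℤ.+ j) ⟩
    ℚᵘ.mkℚᵘ (i ℤ.+ j) 0                     ≈⟨ ℚᵘ.*≡* (cong (ℤ._* + 1) (cong₂ ℤ._+_ (ℤ.*-identityʳ i) (ℤ.*-identityʳ j))) ⟨
    ℚᵘ.mkℚᵘ i 0 ℚᵘ.+ ℚᵘ.mkℚᵘ j 0            ≈⟨ ℚᵘ.+-cong (ι≃ i) (ι≃ j) ⟨
    ℚ.toℚᵘ (ι i) ℚᵘ.+ ℚ.toℚᵘ (ι j)          ≈⟨ ℚ.toℚᵘ-homo-+ (ι i) (ι j) ⟨
    ℚ.toℚᵘ (ι i ℚ.+ ι j)                    ∎)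
    where open ℚᵘ.≃-Reasoning

  ι-* : ∀ i j → ι (i ℤ.* j) ≡ ι i ℚ.* ι j
  ι-* i j = ℚ.toℚᵘ-injective (begin
    ℚ.toℚᵘ (ι (i ℤ.* j))                    ≈⟨ ι≃ (i ℤ.* j) ⟩
    ℚᵘ.mkℚᵘ i 0 ℚᵘ.* ℚᵘ.mkℚᵘ j 0            ≈⟨ ℚᵘ.*-cong (ι≃ i) (ι≃ j) ⟨
    ℚ.toℚᵘ (ι i) ℚᵘ.* ℚ.toℚᵘ (ι j)          ≈⟨ ℚ.toℚᵘ-homo-* (ι i) (ι j) ⟨
    ℚ.toℚᵘ (ι i ℚ.* ι j)                    ∎)
    where open ℚᵘ.≃-Reasoning

ι-- : ∀ i j → ι (i ℤ.- j) ≡ ι i ℚ.- ι j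
ι-- i j = begin
  ι (i ℤ.- j)                        ≡⟨ solve 2 (λ a b → a := a :+ b :- b) refl (ι (i ℤ.- j)) (ι j) ⟩
  ι (i ℤ.- j) ℚ.+ ι j ℚ.- ι j        ≡⟨ cong (ℚ._- ι j) (ι-+ (i ℤ.- j) j) ⟨
  ι (i ℤ.- j ℤ.+ j) ℚ.- ι j          ≡⟨ cong (λ k → ι k ℚ.- ι j) (trans (ℤ.+-assoc i (ℤ.- j) j) (trans (cong (λ k → i ℤ.+ k) (ℤ.+-inverseˡ j)) (ℤ.+-identityʳ i))) ⟩
  ι i ℚ.- ι j                        ∎
  where
  open ≡-Reasoning
  open +-*-Solver

ιₙ-+ : ∀ m n → ιₙ (m ℕ.+ n) ≡ ιₙ m ℚ.+ ιₙ n
ιₙ-+ m n = trans (cong ι (ℤ.pos-+ m n)) (ι-+ (+ m) (+ n))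

ιₙ-* : ∀ m n → ιₙ (m ℕ.* n) ≡ ιₙ m ℚ.* ιₙ n
ιₙ-* m n = trans (cong ι (ℤ.pos-* m n)) (ι-* (+ m) (+ n))

ιₙ-suc : ∀ n → ιₙ (suc n) ≡ 1ℚ ℚ.+ ιₙ n
ιₙ-suc n = trans (ιₙ-+ 1 n) (cong (ℚ._+ ιₙ n) ι1≡1)

opaque
  unfolding ι

  ι-mono-≤ : ∀ {i j} → i ℤ.≤ j → ι i ℚ.≤ ι j
  ι-mono-≤ {i} {j} i≤j = ℚ.toℚᵘ-cancel-≤ (begin
    ℚ.toℚᵘ (ι i)    ≃⟨ ι≃ i ⟩
    ℚᵘ.mkℚᵘ i 0     ≤⟨ ℚᵘ.*≤* (ℤ.*-monoʳ-≤-nonNeg (+ 1) i≤j) ⟩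
    ℚᵘ.mkℚᵘ j 0     ≃⟨ ι≃ j ⟨
    ℚ.toℚᵘ (ι j)    ∎)
    where open ℚᵘ.≤-Reasoning

  ι-mono-< : ∀ {i j} → i ℤ.< j → ι i ℚ.< ι j
  ι-mono-< {i} {j} i<j = ℚ.toℚᵘ-cancel-< (begin-strict
    ℚ.toℚᵘ (ι i)    ≃⟨ ι≃ i ⟩
    ℚᵘ.mkℚᵘ i 0     <⟨ ℚᵘ.*<* (ℤ.*-monoʳ-<-pos (+ 1) i<j) ⟩
    ℚᵘ.mkℚᵘ j 0     ≃⟨ ι≃ j ⟨
    ℚ.toℚᵘ (ι j)    ∎)
    where open ℚᵘ.≤-Reasoning

ι-cancel-≤ : ∀ {i j} → ι i ℚ.≤ ι j → i ℤ.≤ j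
ι-cancel-≤ h = ℤ.≮⇒≥ λ j<i → ℚ.<-irrefl refl (ℚ.≤-<-trans h (ι-mono-< j<i))

ι-cancel-< : ∀ {i j} → ι i ℚ.< ι j → i ℤ.< j
ι-cancel-< h = ℤ.≰⇒> λ j≤i → ℚ.<-irrefl refl (ℚ.<-≤-trans h (ι-mono-≤ j≤i))

ιₙ-mono-≤ : ∀ {m n} → m ℕ.≤ n → ιₙ m ℚ.≤ ιₙ n
ιₙ-mono-≤ m≤n = ι-mono-≤ (ℤ.+≤+ m≤n)

0≤ιₙ : ∀ n → 0ℚ ℚ.≤ ιₙ n
0≤ιₙ n = subst (ℚ._≤ ιₙ n) ι0≡0 (ιₙ-mono-≤ ℕ.z≤n)

0<ιₙ : ∀ {n} → 0 ℕ.< n → 0ℚ ℚ.< ιₙ n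
0<ιₙ {n} 0<n = subst (ℚ._< ιₙ n) ι0≡0 (ι-mono-< (ℤ.+<+ 0<n))

opaque
  unfolding ι

  /-*-cancel : ∀ i d .{{_ : ℕ.NonZero d}} → (i ℚ./ d) ℚ.* ιₙ d ≡ ι i
  /-*-cancel i (suc d) = ℚ.toℚᵘ-injective (begin
    ℚ.toℚᵘ ((i ℚ./ suc d) ℚ.* ιₙ (suc d))            ≈⟨ ℚ.toℚᵘ-homo-* (i ℚ./ suc d) (ιₙ (suc d)) ⟩
    ℚ.toℚᵘ (i ℚ./ suc d) ℚᵘ.* ℚ.toℚᵘ (ιₙ (suc d))    ≈⟨ ℚᵘ.*-cong (ℚ.toℚᵘ-fromℚᵘ (ℚᵘ.mkℚᵘ i d)) (ι≃ (+ suc d)) ⟩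
    ℚᵘ.mkℚᵘ i d ℚᵘ.* ℚᵘ.mkℚᵘ (+ suc d) 0             ≈⟨ ℚᵘ.*≡* (trans (ℤ.*-identityʳ (i ℤ.* + suc d)) (cong (λ k → i ℤ.* + suc k) (sym (ℕ.*-identityʳ d)))) ⟩
    ℚᵘ.mkℚᵘ i 0                                      ≈⟨ ι≃ i ⟨
    ℚ.toℚᵘ (ι i)                                     ∎)
    where open ℚᵘ.≃-Reasoning

↥-↧ : ∀ p → p ℚ.* ιₙ (ℚ.↧ₙ p) ≡ ι (ℚ.↥ p)
↥-↧ p = trans (cong (ℚ._* ιₙ (ℚ.↧ₙ p)) (sym (ℚ.↥p/↧p≡p p))) (/-*-cancel (ℚ.↥ p) (ℚ.↧ₙ p))

0<↧ : ∀ p → 0ℚ ℚ.< ιₙ (ℚ.↧ₙ p)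
0<↧ p = 0<ιₙ (ℕ.s≤s ℕ.z≤n)

archimedean : ∀ p → ∃ λ n → p ℚ.< ιₙ n
archimedean p = suc ℤ.∣ ℚ.↥ p ∣ , ℚ.≤-<-trans bound (ι-mono-< (ℤ.+<+ ℕ.≤-refl))
  where
  i≤+∣i∣ : ∀ i → i ℤ.≤ + ℤ.∣ i ∣
  i≤+∣i∣ (+ n)    = ℤ.≤-refl
  i≤+∣i∣ -[1+ n ] = ℤ.-≤+
  open ℚ.≤-Reasoning
  bound : p ℚ.≤ ιₙ ℤ.∣ ℚ.↥ p ∣
  bound = *-cancelʳ-≤ (ιₙ (ℚ.↧ₙ p)) (0<↧ p) (begin
    p ℚ.* ιₙ (ℚ.↧ₙ p)                     ≡⟨ ↥-↧ p ⟩
    ι (ℚ.↥ p)                             ≤⟨ ι-mono-≤ (i≤+∣i∣ (ℚ.↥ p)) ⟩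
    ιₙ ℤ.∣ ℚ.↥ p ∣                        ≡⟨ cong ιₙ (ℕ.*-identityʳ ℤ.∣ ℚ.↥ p ∣) ⟨
    ιₙ (ℤ.∣ ℚ.↥ p ∣ ℕ.* 1)                ≤⟨ ιₙ-mono-≤ (ℕ.*-monoʳ-≤ ℤ.∣ ℚ.↥ p ∣ (ℕ.s≤s ℕ.z≤n)) ⟩
    ιₙ (ℤ.∣ ℚ.↥ p ∣ ℕ.* ℚ.↧ₙ p)           ≡⟨ ιₙ-* ℤ.∣ ℚ.↥ p ∣ (ℚ.↧ₙ p) ⟩
    ιₙ ℤ.∣ ℚ.↥ p ∣ ℚ.* ιₙ (ℚ.↧ₙ p)        ∎)

-- The unit fraction 1 / (m + 1).
unit : ℕ → ℚ
unit m = recip (ιₙ (suc m)) (0<ιₙ (ℕ.s≤s ℕ.z≤n))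

0<unit : ∀ m → 0ℚ ℚ.< unit m
0<unit m = recip-pos (ιₙ (suc m)) (0<ιₙ (ℕ.s≤s ℕ.z≤n))

*-unit : ∀ m → ιₙ (suc m) ℚ.* unit m ≡ 1ℚ
*-unit m = *-recip (ιₙ (suc m)) (0<ιₙ (ℕ.s≤s ℕ.z≤n))

unit-antimono : ∀ {m n} → m ℕ.≤ n → unit n ℚ.≤ unit m
unit-antimono {m} {n} m≤n = begin
  unit n                                ≡⟨ ℚ.*-identityˡ (unit n) ⟨
  1ℚ ℚ.* unit n                         ≡⟨ cong (ℚ._* unit n) (*-unit m) ⟨
  ιₙ (suc m) ℚ.* unit m ℚ.* unit n      ≤⟨ *-monoʳ-≤ (unit n) (ℚ.<⇒≤ (0<unit n)) (*-monoʳ-≤ (unit m) (ℚ.<⇒≤ (0<unit m)) (ιₙ-mono-≤ (ℕ.s≤s m≤n))) ⟩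
  ιₙ (suc n) ℚ.* unit m ℚ.* unit n      ≡⟨ swap (ιₙ (suc n)) (unit m) (unit n) ⟩
  ιₙ (suc n) ℚ.* unit n ℚ.* unit m      ≡⟨ cong (ℚ._* unit m) (*-unit n) ⟩
  1ℚ ℚ.* unit m                         ≡⟨ ℚ.*-identityˡ (unit m) ⟩
  unit m                                ∎
  where
  open ℚ.≤-Reasoning
  open +-*-Solver
  swap : ∀ a b c → a ℚ.* b ℚ.* c ≡ a ℚ.* c ℚ.* b
  swap = solve 3 (λ a b c → a :* b :* c := a :* c :* b) refl

-- The fractions K / (m + 1) tend to zero.
unit-small : ∀ K ε → 0ℚ ℚ.< ε → ∃ λ N → ∀ m → N ℕ.≤ m → 0ℚ ℚ.≤ K → K ℚ.* unit m ℚ.< ε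
unit-small K ε 0<ε =
  let N , K/ε<N = archimedean (K ℚ.* recip ε 0<ε)
  in N , λ m N≤m 0≤K → *-cancelʳ-< (ιₙ (suc m)) (0<ιₙ (ℕ.s≤s ℕ.z≤n)) (begin-strict
    K ℚ.* unit m ℚ.* ιₙ (suc m)       ≡⟨ shuffle K (unit m) (ιₙ (suc m)) ⟩
    K ℚ.* (ιₙ (suc m) ℚ.* unit m)     ≡⟨ cong (K ℚ.*_) (trans (*-unit m) (sym (*-recip ε 0<ε))) ⟩
    K ℚ.* (ε ℚ.* recip ε 0<ε)         ≡⟨ shuffle′ K ε (recip ε 0<ε) ⟩
    ε ℚ.* (K ℚ.* recip ε 0<ε)         <⟨ *-monoˡ-< ε 0<ε K/ε<N ⟩
    ε ℚ.* ιₙ N                        ≤⟨ *-monoˡ-≤ ε (ℚ.<⇒≤ 0<ε) (ιₙ-mono-≤ (ℕ.m≤n⇒m≤1+n N≤m)) ⟩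
    ε ℚ.* ιₙ (suc m)                  ∎)
  where
  open ℚ.≤-Reasoning
  open +-*-Solver
  shuffle : ∀ a b c → a ℚ.* b ℚ.* c ≡ a ℚ.* (c ℚ.* b)
  shuffle = solve 3 (λ a b c → a :* b :* c := a :* (c :* b)) refl
  shuffle′ : ∀ a b c → a ℚ.* (b ℚ.* c) ≡ b ℚ.* (a ℚ.* c)
  shuffle′ = solve 3 (λ a b c → a :* (b :* c) := b :* (a :* c)) refl

-- Comparison of the fractions a / (m + 1) and b / (n + 1) by cross-multiplication.
module _ (a b : ℤ) (m n : ℕ) where
  private
    M N u v : ℚ
    M = ιₙ (suc m)
    N = ιₙ (suc n)
    u = unit m
    v = unit n

    0<uv : 0ℚ ℚ.< u ℚ.* v
    0<uv = pos-* (0<unit m) (0<unit n)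

    open +-*-Solver

    left : ι (a ℤ.* + suc n) ℚ.* (u ℚ.* v) ≡ ι a ℚ.* u
    left = begin
      ι (a ℤ.* + suc n) ℚ.* (u ℚ.* v)    ≡⟨ cong (ℚ._* (u ℚ.* v)) (ι-* a (+ suc n)) ⟩
      ι a ℚ.* N ℚ.* (u ℚ.* v)            ≡⟨ solve 4 (λ a N u v → a :* N :* (u :* v) := a :* u :* (N :* v)) refl (ι a) N u v ⟩
      ι a ℚ.* u ℚ.* (N ℚ.* v)            ≡⟨ cong (ι a ℚ.* u ℚ.*_) (*-unit n) ⟩
      ι a ℚ.* u ℚ.* 1ℚ                   ≡⟨ ℚ.*-identityʳ _ ⟩
      ι a ℚ.* u                          ∎
      where open ≡-Reasoning

    right : ι (b ℤ.* + suc m) ℚ.* (u ℚ.* v) ≡ ι b ℚ.* v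
    right = begin
      ι (b ℤ.* + suc m) ℚ.* (u ℚ.* v)    ≡⟨ cong (ℚ._* (u ℚ.* v)) (ι-* b (+ suc m)) ⟩
      ι b ℚ.* M ℚ.* (u ℚ.* v)            ≡⟨ solve 4 (λ b M u v → b :* M :* (u :* v) := b :* v :* (M :* u)) refl (ι b) M u v ⟩
      ι b ℚ.* v ℚ.* (M ℚ.* u)            ≡⟨ cong (ι b ℚ.* v ℚ.*_) (*-unit m) ⟩
      ι b ℚ.* v ℚ.* 1ℚ                   ≡⟨ ℚ.*-identityʳ _ ⟩
      ι b ℚ.* v                          ∎
      where open ≡-Reasoning

  cross-≤ : a ℤ.* + suc n ℤ.≤ b ℤ.* + suc m → ι a ℚ.* u ℚ.≤ ι b ℚ.* v
  cross-≤ h = subst₂ ℚ._≤_ left right (*-monoʳ-≤ (u ℚ.* v) (ℚ.<⇒≤ 0<uv) (ι-mono-≤ h))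

  cross-< : ι a ℚ.* u ℚ.< ι b ℚ.* v → a ℤ.* + suc n ℤ.< b ℤ.* + suc m
  cross-< h = ι-cancel-< (*-cancelʳ-< (u ℚ.* v) 0<uv (subst₂ ℚ._<_ (sym left) (sym right) h))

≡-fraction : ∀ r → r ≡ ι (ℚ.↥ r) ℚ.* unit (ℚ.denominator-1 r)
≡-fraction r = begin
  r                                  ≡⟨ ℚ.*-identityʳ r ⟨
  r ℚ.* 1ℚ                           ≡⟨ cong (r ℚ.*_) (*-unit d) ⟨
  r ℚ.* (ιₙ (suc d) ℚ.* unit d)      ≡⟨ ℚ.*-assoc r (ιₙ (suc d)) (unit d) ⟨
  r ℚ.* ιₙ (suc d) ℚ.* unit d        ≡⟨ cong (ℚ._* unit d) (↥-↧ r) ⟩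
  ι (ℚ.↥ r) ℚ.* unit d               ∎
  where
  d = ℚ.denominator-1 r
  open ≡-Reasoning

-- Powers of rationals

0≤^ : ∀ {a} → 0ℚ ℚ.≤ a → ∀ m → 0ℚ ℚ.≤ a ^ᵠ m
0≤^ 0≤a zero    = ℚ.<⇒≤ (ℚ.positive⁻¹ 1ℚ)
0≤^ 0≤a (suc m) = *-nonNeg 0≤a (0≤^ 0≤a m)

0<^ : ∀ {a} → 0ℚ ℚ.< a → ∀ m → 0ℚ ℚ.< a ^ᵠ m
0<^ 0<a zero    = ℚ.positive⁻¹ 1ℚ
0<^ 0<a (suc m) = pos-* 0<a (0<^ 0<a m)

^-mono-≤ : ∀ {a b} → 0ℚ ℚ.≤ a → a ℚ.≤ b → ∀ m → a ^ᵠ m ℚ.≤ b ^ᵠ m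
^-mono-≤ 0≤a a≤b zero    = ℚ.≤-refl
^-mono-≤ 0≤a a≤b (suc m) =
  *-mono-≤-nonNeg 0≤a (0≤^ (ℚ.≤-trans 0≤a a≤b) m) a≤b (^-mono-≤ 0≤a a≤b m)

^-swap : ∀ a m n → (a ^ᵠ m) ^ᵠ n ≡ (a ^ᵠ n) ^ᵠ m
^-swap a m n = trans (^ᵠ-assocʳ a m n) (trans (cong (a ^ᵠ_) (ℕ.*-comm m n)) (sym (^ᵠ-assocʳ a n m)))

1^ : ∀ m → 1ℚ ^ᵠ m ≡ 1ℚ
1^ zero    = refl
1^ (suc m) = trans (ℚ.*-identityˡ (1ℚ ^ᵠ m)) (1^ m)

bernoulli : ∀ {η} → 0ℚ ℚ.≤ η → η ℚ.≤ 1ℚ → ∀ m → 1ℚ ℚ.- ιₙ m ℚ.* η ℚ.≤ (1ℚ ℚ.- η) ^ᵠ m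
bernoulli {η} 0≤η η≤1 zero    = ℚ.≤-reflexive (trans (cong (λ z → 1ℚ ℚ.- z ℚ.* η) ι0≡0) (cong (λ z → 1ℚ ℚ.- z) (ℚ.*-zeroˡ η)))
bernoulli {η} 0≤η η≤1 (suc m) = begin
  1ℚ ℚ.- ιₙ (suc m) ℚ.* η                       ≡⟨ cong (λ z → 1ℚ ℚ.- z ℚ.* η) (ιₙ-suc m) ⟩
  1ℚ ℚ.- (1ℚ ℚ.+ ιₙ m) ℚ.* η                    ≤⟨ ≤-diff (*-nonNeg (0≤ιₙ m) (*-nonNeg 0≤η 0≤η)) (expand (ιₙ m) η) ⟩
  (1ℚ ℚ.- η) ℚ.* (1ℚ ℚ.- ιₙ m ℚ.* η)            ≤⟨ *-monoˡ-≤ (1ℚ ℚ.- η) 0≤1-η (bernoulli 0≤η η≤1 m) ⟩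
  (1ℚ ℚ.- η) ℚ.* (1ℚ ℚ.- η) ^ᵠ m                ∎
  where
  open ℚ.≤-Reasoning
  open +-*-Solver
  expand : ∀ m η → m ℚ.* (η ℚ.* η) ℚ.- 0ℚ ≡
    (1ℚ ℚ.- η) ℚ.* (1ℚ ℚ.- m ℚ.* η) ℚ.- (1ℚ ℚ.- (1ℚ ℚ.+ m) ℚ.* η)
  expand = solve 2 (λ m η → m :* (η :* η) :- con 0ℚ :=
    (con 1ℚ :- η) :* (con 1ℚ :- m :* η) :- (con 1ℚ :- (con 1ℚ :+ m) :* η)) refl
  0≤1-η : 0ℚ ℚ.≤ 1ℚ ℚ.- η
  0≤1-η = ≤-diff η≤1 (solve 1 (λ η → con 1ℚ :- η := (con 1ℚ :- η) :- con 0ℚ) refl η)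

-- slack m = 1 / (2 (m + 1)), and shrink m = 1 - slack m is a factor below 1 whose
-- m-th power stays above ½ by Bernoulli's inequality.
slack : ℕ → ℚ
slack m = ½ ℚ.* unit m

shrink : ℕ → ℚ
shrink m = 1ℚ ℚ.- slack m

0<slack : ∀ m → 0ℚ ℚ.< slack m
0<slack m = pos-* 0<½ (0<unit m)

unit0≡1 : unit 0 ≡ 1ℚ
unit0≡1 = trans (sym (ℚ.*-identityˡ (unit 0))) (trans (cong (ℚ._* unit 0) (sym ι1≡1)) (*-unit 0))

slack<1 : ∀ m → slack m ℚ.< 1ℚ
slack<1 m = begin-strict
  ½ ℚ.* unit m      ≤⟨ *-monoˡ-≤ ½ (ℚ.<⇒≤ 0<½) (unit-antimono {0} {m} ℕ.z≤n) ⟩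
  ½ ℚ.* unit 0      ≡⟨ cong (½ ℚ.*_) unit0≡1 ⟩
  ½                 <⟨ ℚ.*<* (ℤ.+<+ (ℕ.s≤s (ℕ.s≤s ℕ.z≤n))) ⟩
  1ℚ                ∎
  where open ℚ.≤-Reasoning

0<shrink : ∀ m → 0ℚ ℚ.< shrink m
0<shrink m = <-diff (slack<1 m) (solve 1 (λ η → con 1ℚ :- η := (con 1ℚ :- η) :- con 0ℚ) refl (slack m))
  where open +-*-Solver

½<shrink^ : ∀ m → ½ ℚ.< shrink m ^ᵠ m
½<shrink^ m = begin-strict
  ½                                                     ≡⟨ ℚ.+-identityʳ ½ ⟨
  ½ ℚ.+ 0ℚ                                              <⟨ ℚ.+-monoʳ-< ½ (0<slack m) ⟩
  ½ ℚ.* 1ℚ ℚ.+ slack m                                  ≡⟨ cong (λ z → ½ ℚ.* z ℚ.+ slack m) [1+m]u≡1 ⟨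
  ½ ℚ.* ((1ℚ ℚ.+ ιₙ m) ℚ.* unit m) ℚ.+ slack m          ≡⟨ rearrange (ιₙ m) (unit m) ⟩
  (1ℚ ℚ.+ ιₙ m) ℚ.* unit m ℚ.- ιₙ m ℚ.* slack m         ≡⟨ cong (ℚ._- ιₙ m ℚ.* slack m) [1+m]u≡1 ⟩
  1ℚ ℚ.- ιₙ m ℚ.* slack m                               ≤⟨ bernoulli (ℚ.<⇒≤ (0<slack m)) (ℚ.<⇒≤ (slack<1 m)) m ⟩
  shrink m ^ᵠ m                                         ∎
  where
  open ℚ.≤-Reasoning
  open +-*-Solver
  [1+m]u≡1 : (1ℚ ℚ.+ ιₙ m) ℚ.* unit m ≡ 1ℚ
  [1+m]u≡1 = trans (cong (ℚ._* unit m) (sym (ιₙ-suc m))) (*-unit m)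
  rearrange : ∀ m u → ½ ℚ.* ((1ℚ ℚ.+ m) ℚ.* u) ℚ.+ ½ ℚ.* u ≡ (1ℚ ℚ.+ m) ℚ.* u ℚ.- m ℚ.* (½ ℚ.* u)
  rearrange = solve 2 (λ m u → con ½ :* ((con 1ℚ :+ m) :* u) :+ con ½ :* u :=
    (con 1ℚ :+ m) :* u :- m :* (con ½ :* u)) refl

2ℚ : ℚ
2ℚ = + 2 ℚ./ 1

shrink-^ : ∀ {a b} m → 0ℚ ℚ.< b → b ℚ.* shrink m ℚ.≤ a → b ^ᵠ m ℚ.< 2ℚ ℚ.* a ^ᵠ m
shrink-^ {a} {b} m 0<b bs≤a = begin-strict
  b ^ᵠ m                                ≡⟨ halves (b ^ᵠ m) ⟩
  2ℚ ℚ.* (b ^ᵠ m ℚ.* ½)                 <⟨ *-monoˡ-< 2ℚ (ℚ.positive⁻¹ 2ℚ) (*-monoˡ-< (b ^ᵠ m) (0<^ 0<b m) (½<shrink^ m)) ⟩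
  2ℚ ℚ.* (b ^ᵠ m ℚ.* shrink m ^ᵠ m)     ≡⟨ cong (2ℚ ℚ.*_) (^ᵠ-distrib-* b (shrink m) m) ⟨
  2ℚ ℚ.* (b ℚ.* shrink m) ^ᵠ m          ≤⟨ *-monoˡ-≤ 2ℚ (ℚ.<⇒≤ (ℚ.positive⁻¹ 2ℚ)) (^-mono-≤ (ℚ.<⇒≤ (pos-* 0<b (0<shrink m))) bs≤a m) ⟩
  2ℚ ℚ.* a ^ᵠ m                         ∎
  where
  open ℚ.≤-Reasoning
  open +-*-Solver
  halves : ∀ b → b ≡ 2ℚ ℚ.* (b ℚ.* ½)
  halves = solve 1 (λ b → b := con 2ℚ :* (b :* con ½)) refl

-- If b ^ m is at least twice a ^ m, then a is smaller than b by a definite factor.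
root-gap : ∀ a b m → 0ℚ ℚ.< b → 2ℚ ℚ.* a ^ᵠ m ℚ.≤ b ^ᵠ m → a ℚ.≤ b ℚ.* shrink m
root-gap a b m 0<b h = ℚ.≮⇒≥ λ bs<a →
  ℚ.<-irrefl refl (ℚ.<-≤-trans (shrink-^ m 0<b (ℚ.<⇒≤ bs<a)) h)

-- A multiplicative gap a ≤ b * shrink m as an additive one.
gap⁺ : ∀ a b m → 0ℚ ℚ.≤ b → a ℚ.≤ b ℚ.* shrink m → a ℚ.+ slack m ℚ.* b ℚ.≤ b
gap⁺ a b m 0≤b h = ≤-diff h (rearrange a b (slack m))
  where
  open +-*-Solver
  rearrange : ∀ a b σ → b ℚ.* (1ℚ ℚ.- σ) ℚ.- a ≡ b ℚ.- (a ℚ.+ σ ℚ.* b)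
  rearrange = solve 3 (λ a b σ → b :* (con 1ℚ :- σ) :- a := b :- (a :+ σ :* b)) refl

-- Integer powers of two

opaque
  unfolding ι

  2^-+suc : ∀ n → 2^ (+ suc n) ≡ 2ℚ ℚ.* 2^ (+ n)
  2^-+suc n = trans (cong ι (ℤ.pos-* 2 (2 ℕ.^ n))) (ι-* (+ 2) (+ (2 ℕ.^ n)))

  2^ιₙ : ∀ n → 2^ (+ n) ≡ ιₙ (2 ℕ.^ n)
  2^ιₙ n = refl

2^-inverse : ∀ n → 2^ (ℤ.- (+ n)) ℚ.* 2^ (+ n) ≡ 1ℚ
2^-inverse zero    = refl
2^-inverse (suc n) = trans
  (cong (2^ -[1+ n ] ℚ.*_) (2^ιₙ (suc n)))
  (trans (/-*-cancel (+ 1) (2 ℕ.^ suc n) {{ℕ.m^n≢0 2 (suc n)}}) ι1≡1)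

0<2^+ : ∀ n → 0ℚ ℚ.< 2^ (+ n)
0<2^+ n = subst (0ℚ ℚ.<_) (sym (2^ιₙ n)) (0<ιₙ (ℕ.m^n>0 2 n))

0<2^ : ∀ i → 0ℚ ℚ.< 2^ i
0<2^ (+ n)    = 0<2^+ n
0<2^ -[1+ n ] = *-cancelʳ-< (2^ (+ suc n)) (0<2^+ (suc n))
  (subst₂ ℚ._<_ (sym (ℚ.*-zeroˡ (2^ (+ suc n)))) (sym (2^-inverse (suc n))) (ℚ.positive⁻¹ 1ℚ))

2^-suc : ∀ i → 2^ (ℤ.suc i) ≡ 2ℚ ℚ.* 2^ i
2^-suc (+ n)        = 2^-+suc n
2^-suc -[1+ zero  ] = refl
2^-suc -[1+ suc n ] = begin
  2^ -[1+ n ]                                                    ≡⟨ ℚ.*-identityˡ _ ⟨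
  1ℚ ℚ.* 2^ -[1+ n ]                                             ≡⟨ cong (ℚ._* 2^ -[1+ n ]) (2^-inverse (suc (suc n))) ⟨
  2^ -[1+ suc n ] ℚ.* 2^ (+ suc (suc n)) ℚ.* 2^ -[1+ n ]         ≡⟨ cong (λ z → 2^ -[1+ suc n ] ℚ.* z ℚ.* 2^ -[1+ n ]) (2^-+suc (suc n)) ⟩
  2^ -[1+ suc n ] ℚ.* (2ℚ ℚ.* 2^ (+ suc n)) ℚ.* 2^ -[1+ n ]      ≡⟨ rearrange (2^ -[1+ suc n ]) (2^ (+ suc n)) (2^ -[1+ n ]) ⟩
  2ℚ ℚ.* 2^ -[1+ suc n ] ℚ.* (2^ -[1+ n ] ℚ.* 2^ (+ suc n))      ≡⟨ cong (2ℚ ℚ.* 2^ -[1+ suc n ] ℚ.*_) (2^-inverse (suc n)) ⟩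
  2ℚ ℚ.* 2^ -[1+ suc n ] ℚ.* 1ℚ                                  ≡⟨ ℚ.*-identityʳ _ ⟩
  2ℚ ℚ.* 2^ -[1+ suc n ]                                         ∎
  where
  open ≡-Reasoning
  open +-*-Solver
  rearrange : ∀ a b c → a ℚ.* (2ℚ ℚ.* b) ℚ.* c ≡ 2ℚ ℚ.* a ℚ.* (c ℚ.* b)
  rearrange = solve 3 (λ a b c → a :* (con 2ℚ :* b) :* c := con 2ℚ :* a :* (c :* b)) refl

2^-++ : ∀ i n → 2^ (i ℤ.+ + n) ≡ 2^ i ℚ.* 2^ (+ n)
2^-++ i zero    = trans (cong 2^ (ℤ.+-identityʳ i)) (sym (ℚ.*-identityʳ (2^ i)))
2^-++ i (suc n) = begin
  2^ (i ℤ.+ + suc n)             ≡⟨ cong 2^ (trans (ℤ.+-comm i (+ suc n)) (trans (ℤ.+-assoc (+ 1) (+ n) i) (cong ℤ.suc (ℤ.+-comm (+ n) i)))) ⟩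
  2^ (ℤ.suc (i ℤ.+ + n))         ≡⟨ 2^-suc (i ℤ.+ + n) ⟩
  2ℚ ℚ.* 2^ (i ℤ.+ + n)          ≡⟨ cong (2ℚ ℚ.*_) (2^-++ i n) ⟩
  2ℚ ℚ.* (2^ i ℚ.* 2^ (+ n))     ≡⟨ rearrange (2^ i) (2^ (+ n)) ⟩
  2^ i ℚ.* (2ℚ ℚ.* 2^ (+ n))     ≡⟨ cong (2^ i ℚ.*_) (2^-+suc n) ⟨
  2^ i ℚ.* 2^ (+ suc n)          ∎
  where
  open ≡-Reasoning
  open +-*-Solver
  rearrange : ∀ a b → 2ℚ ℚ.* (a ℚ.* b) ≡ a ℚ.* (2ℚ ℚ.* b)
  rearrange = solve 2 (λ a b → con 2ℚ :* (a :* b) := a :* (con 2ℚ :* b)) refl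

2^-+ : ∀ i j → 2^ (i ℤ.+ j) ≡ 2^ i ℚ.* 2^ j
2^-+ i (+ n)    = 2^-++ i n
2^-+ i -[1+ n ] = begin
  2^ (i ℤ.+ j)                             ≡⟨ ℚ.*-identityʳ _ ⟨
  2^ (i ℤ.+ j) ℚ.* 1ℚ                      ≡⟨ cong (2^ (i ℤ.+ j) ℚ.*_) (2^-inverse (suc n)) ⟨
  2^ (i ℤ.+ j) ℚ.* (2^ j ℚ.* 2^ k)         ≡⟨ rearrange (2^ (i ℤ.+ j)) (2^ j) (2^ k) ⟩
  2^ (i ℤ.+ j) ℚ.* 2^ k ℚ.* 2^ j           ≡⟨ cong (ℚ._* 2^ j) (2^-++ (i ℤ.+ j) (suc n)) ⟨
  2^ (i ℤ.+ j ℤ.+ k) ℚ.* 2^ j              ≡⟨ cong (λ e → 2^ e ℚ.* 2^ j) (trans (ℤ.+-assoc i j k) (trans (cong (λ e → i ℤ.+ e) (ℤ.+-inverseˡ k)) (ℤ.+-identityʳ i))) ⟩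
  2^ i ℚ.* 2^ j                            ∎
  where
  j = -[1+ n ]
  k = + suc n
  open ≡-Reasoning
  open +-*-Solver
  rearrange : ∀ a b c → a ℚ.* (b ℚ.* c) ≡ a ℚ.* c ℚ.* b
  rearrange = solve 3 (λ a b c → a :* (b :* c) := a :* c :* b) refl

2^-^ : ∀ i m → 2^ i ^ᵠ m ≡ 2^ (i ℤ.* + m)
2^-^ i zero    = cong 2^ (sym (ℤ.*-zeroʳ i))
2^-^ i (suc m) = trans (cong (2^ i ℚ.*_) (2^-^ i m)) (trans (sym (2^-+ i (i ℤ.* + m))) (cong 2^ (sym (ℤ.*-suc i (+ m)))))

1≤2^ : ∀ n → 1ℚ ℚ.≤ 2^ (+ n)
1≤2^ n = subst₂ ℚ._≤_ ι1≡1 (sym (2^ιₙ n)) (ιₙ-mono-≤ (ℕ.m^n>0 2 n))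

2^-mono-≤ : ∀ {i j} → i ℤ.≤ j → 2^ i ℚ.≤ 2^ j
2^-mono-≤ {i} {j} i≤j = begin
  2^ i                      ≡⟨ ℚ.*-identityʳ (2^ i) ⟨
  2^ i ℚ.* 1ℚ               ≤⟨ *-monoˡ-≤ (2^ i) (ℚ.<⇒≤ (0<2^ i)) (1≤2^ d) ⟩
  2^ i ℚ.* 2^ (+ d)         ≡⟨ 2^-+ i (+ d) ⟨
  2^ (i ℤ.+ + d)            ≡⟨ cong (λ e → 2^ (i ℤ.+ e)) (ℤ.0≤i⇒+∣i∣≡i (ℤ.i≤j⇒0≤j-i i≤j)) ⟩
  2^ (i ℤ.+ (j ℤ.- i))      ≡⟨ cong 2^ (trans (ℤ.+-comm i (j ℤ.- i)) (trans (ℤ.+-assoc j (ℤ.- i) i) (trans (cong (λ e → j ℤ.+ e) (ℤ.+-inverseˡ i)) (ℤ.+-identityʳ j)))) ⟩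
  2^ j                      ∎
  where
  open ℚ.≤-Reasoning
  d = ℤ.∣ j ℤ.- i ∣

2^-double : ∀ {i j} → i ℤ.< j → 2ℚ ℚ.* 2^ i ℚ.≤ 2^ j
2^-double {i} {j} i<j = subst (ℚ._≤ 2^ j) (2^-suc i) (2^-mono-≤ (ℤ.i<j⇒suc[i]≤j i<j))

2^-mono-< : ∀ {i j} → i ℤ.< j → 2^ i ℚ.< 2^ j
2^-mono-< {i} {j} i<j = ℚ.<-≤-trans
  (<-diff (0<2^ i) (solve 1 (λ p → p :- con 0ℚ := con 2ℚ :* p :- p) refl (2^ i)))
  (2^-double i<j)
  where open +-*-Solver

2^-cancel-≤ : ∀ {i j} → 2^ i ℚ.≤ 2^ j → i ℤ.≤ j
2^-cancel-≤ h = ℤ.≮⇒≥ λ j<i → ℚ.<-irrefl refl (ℚ.≤-<-trans h (2^-mono-< j<i))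

n<2^n : ∀ n → n ℕ.< 2 ℕ.^ n
n<2^n zero    = ℕ.s≤s ℕ.z≤n
n<2^n (suc n) = ℕ.+-mono-≤ (ℕ.m^n>0 2 n) (subst (n ℕ.<_) (sym (ℕ.+-identityʳ (2 ℕ.^ n))) (n<2^n n))

below-2^ : ∀ a → ∃ λ n → a ℚ.< 2^ (+ n)
below-2^ a =
  let n , a<n = archimedean a
  in n , ℚ.<-≤-trans a<n (subst (ιₙ n ℚ.≤_) (sym (2^ιₙ n)) (ιₙ-mono-≤ (ℕ.<⇒≤ (n<2^n n))))

above-2^ : ∀ a → 0ℚ ℚ.< a → ∃ λ n → 2^ (ℤ.- (+ n)) ℚ.≤ a
above-2^ a 0<a =
  let n , 1/a<2ⁿ = below-2^ (recip a 0<a)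
  in n , *-cancelʳ-≤ (2^ (+ n)) (0<2^ (+ n)) (begin
    2^ (ℤ.- (+ n)) ℚ.* 2^ (+ n)      ≡⟨ 2^-inverse n ⟩
    1ℚ                               ≡⟨ *-recip a 0<a ⟨
    a ℚ.* recip a 0<a                ≤⟨ *-monoˡ-≤ a (ℚ.<⇒≤ 0<a) (ℚ.<⇒≤ 1/a<2ⁿ) ⟩
    a ℚ.* 2^ (+ n)                   ∎)
  where open ℚ.≤-Reasoning

opaque
  -- The integer part of the binary logarithm of a positive rational.
  floor-log₂ : ∀ a → 0ℚ ℚ.< a → ∃ λ k → 2^ k ℚ.≤ a × a ℚ.< 2^ (ℤ.suc k)
  floor-log₂ a 0<a with above-2^ a 0<a | below-2^ a
  ... | m , lo | n , hi =
    search (ℤ.- (+ m)) (m ℕ.+ n) lo (subst (λ e → a ℚ.< 2^ e) (sym end) hi)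
    where
    end : ℤ.- (+ m) ℤ.+ + (m ℕ.+ n) ≡ + n
    end = trans (cong (λ e → ℤ.- (+ m) ℤ.+ e) (ℤ.pos-+ m n))
      (trans (sym (ℤ.+-assoc (ℤ.- (+ m)) (+ m) (+ n)))
        (trans (cong (λ e → e ℤ.+ + n) (ℤ.+-inverseˡ (+ m))) (ℤ.+-identityˡ (+ n))))
    search : ∀ k fuel → 2^ k ℚ.≤ a → a ℚ.< 2^ (k ℤ.+ + fuel) → ∃ λ k → 2^ k ℚ.≤ a × a ℚ.< 2^ (ℤ.suc k)
    search k zero       lo hi = ⊥-elim (ℚ.<-irrefl refl
      (ℚ.≤-<-trans lo (subst (λ e → a ℚ.< 2^ e) (ℤ.+-identityʳ k) hi)))
    search k (suc fuel) lo hi with a ℚ.<? 2^ (ℤ.suc k)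
    ... | yes h = k , lo , h
    ... | no ¬h = search (ℤ.suc k) fuel (ℚ.≮⇒≥ ¬h) (subst (λ e → a ℚ.< 2^ e) shift hi)
      where
      shift : k ℤ.+ + suc fuel ≡ ℤ.suc k ℤ.+ + fuel
      shift = trans (sym (ℤ.+-assoc k (+ 1) (+ fuel))) (cong (λ e → e ℤ.+ + fuel) (ℤ.+-comm k (+ 1)))

-- Sequences and the order of the reals

-- P holds for all but finitely many indices.
Eventually : (ℕ → Set) → Set
Eventually P = ∃ λ N → ∀ n → N ℕ.≤ n → P n

ev-map : ∀ {P Q : ℕ → Set} → (∀ n → P n → Q n) → Eventually P → Eventually Q
ev-map f (N , h) = N , λ n N≤n → f n (h n N≤n)

ev-× : ∀ {P Q : ℕ → Set} → Eventually P → Eventually Q → Eventually (λ n → P n × Q n)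
ev-× (M , g) (N , h) = M ℕ.⊔ N , λ n le →
  g n (ℕ.≤-trans (ℕ.m≤m⊔n M N) le) , h n (ℕ.≤-trans (ℕ.m≤n⊔m M N) le)

ev-∃ : ∀ {P : ℕ → Set} → Eventually P → ∃ P
ev-∃ (N , h) = N , h N ℕ.≤-refl

∣p-q∣<r⇒p<q+r : ∀ p q {r} → ℚ.∣ p ℚ.- q ∣ ℚ.< r → p ℚ.< q ℚ.+ r
∣p-q∣<r⇒p<q+r p q {r} h = <-diff (ℚ.≤-<-trans (p≤∣p∣ (p ℚ.- q)) h)
  (solve 3 (λ p q r → r :- (p :- q) := (q :+ r) :- p) refl p q r)
  where open +-*-Solver

∣q-p∣<r⇒p<q+r : ∀ p q {r} → ℚ.∣ q ℚ.- p ∣ ℚ.< r → p ℚ.< q ℚ.+ r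
∣q-p∣<r⇒p<q+r p q h = ∣p-q∣<r⇒p<q+r p q (subst (ℚ._< _) (∣p-q∣≡∣q-p∣ q p) h)

ev-≤⇒≤ : ∀ x y → (∀ ε → 0ℚ ℚ.< ε → Eventually λ n → seq x n ℚ.≤ seq y n ℚ.+ ε) → x ≤ y
ev-≤⇒≤ x y h (ε , 0<ε , y+ε≤x) with ev-∃ (ev-× (h (½ ℚ.* ε) (pos-* 0<½ 0<ε)) y+ε≤x)
... | n , x≤y+ε/2 , y+ε≤x′ = ℚ.<-irrefl refl
  (ℚ.<-≤-trans (<-diff (pos-* 0<½ 0<ε) (rearrange (seq y n) ε)) (ℚ.≤-trans y+ε≤x′ x≤y+ε/2))
  where
  open +-*-Solver
  rearrange : ∀ y ε → ½ ℚ.* ε ℚ.- 0ℚ ≡ (y ℚ.+ ε) ℚ.- (y ℚ.+ ½ ℚ.* ε)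
  rearrange = solve 2 (λ y ε → con ½ :* ε :- con 0ℚ := (y :+ ε) :- (y :+ con ½ :* ε)) refl

≤⇒ev-< : ∀ x y → x ≤ y → ∀ ε → 0ℚ ℚ.< ε → Eventually λ n → seq x n ℚ.< seq y n ℚ.+ ε
≤⇒ev-< x y x≤y ε 0<ε = N , near
  where
  δ = ½ ℚ.* (½ ℚ.* (½ ℚ.* ε))
  0<δ = pos-* 0<½ (pos-* 0<½ (pos-* 0<½ 0<ε))
  Nx = proj₁ (cauchy x δ 0<δ)
  Ny = proj₁ (cauchy y δ 0<δ)
  N = Nx ℕ.⊔ Ny
  open ℚ.≤-Reasoning
  open +-*-Solver

  xNear : ∀ n → N ℕ.≤ n → ℚ.∣ seq x N ℚ.- seq x n ∣ ℚ.< δ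
  xNear n N≤n = proj₂ (cauchy x δ 0<δ) N n (ℕ.m≤m⊔n Nx Ny) (ℕ.≤-trans (ℕ.m≤m⊔n Nx Ny) N≤n)
  yNear : ∀ n → N ℕ.≤ n → ℚ.∣ seq y N ℚ.- seq y n ∣ ℚ.< δ
  yNear n N≤n = proj₂ (cauchy y δ 0<δ) N n (ℕ.m≤n⊔m Nx Ny) (ℕ.≤-trans (ℕ.m≤n⊔m Nx Ny) N≤n)

  3ℚ = + 3 ℚ./ 1
  δ′ : ∀ {n} → Polynomial n → Polynomial n
  δ′ ε = con ½ :* (con ½ :* (con ½ :* ε))

  -- A gap of 3 δ at the index N would leave one of δ at all later indices.
  gap : ¬ (seq y N ℚ.+ (δ ℚ.+ δ ℚ.+ δ) ℚ.≤ seq x N)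
  gap h = x≤y (δ , 0<δ , N , λ n N≤n → ℚ.<⇒≤ (begin-strict
    seq y n ℚ.+ δ                       <⟨ ℚ.+-monoˡ-< δ (∣q-p∣<r⇒p<q+r (seq y n) (seq y N) (yNear n N≤n)) ⟩
    seq y N ℚ.+ δ ℚ.+ δ                 ≤⟨ ≤-diff h (solve 3 (λ x y δ → x :- (y :+ (δ :+ δ :+ δ)) := (x :- δ) :- (y :+ δ :+ δ)) refl (seq x N) (seq y N) δ) ⟩
    seq x N ℚ.- δ                       <⟨ <-diff (∣p-q∣<r⇒p<q+r (seq x N) (seq x n) (xNear n N≤n)) (solve 3 (λ x x′ δ → (x′ :+ δ) :- x := x′ :- (x :- δ)) refl (seq x N) (seq x n) δ) ⟩
    seq x n                             ∎))

  near : ∀ n → N ℕ.≤ n → seq x n ℚ.< seq y n ℚ.+ ε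
  near n N≤n = begin-strict
    seq x n                                   <⟨ ∣q-p∣<r⇒p<q+r (seq x n) (seq x N) (xNear n N≤n) ⟩
    seq x N ℚ.+ δ                             <⟨ ℚ.+-monoˡ-< δ (ℚ.≰⇒> gap) ⟩
    seq y N ℚ.+ (δ ℚ.+ δ ℚ.+ δ) ℚ.+ δ         <⟨ ℚ.+-monoˡ-< δ (ℚ.+-monoˡ-< (δ ℚ.+ δ ℚ.+ δ) (∣p-q∣<r⇒p<q+r (seq y N) (seq y n) (yNear n N≤n))) ⟩
    seq y n ℚ.+ δ ℚ.+ (δ ℚ.+ δ ℚ.+ δ) ℚ.+ δ   <⟨ <-diff (pos-* (ℚ.positive⁻¹ 3ℚ) 0<δ) (solve 2 (λ y ε → con 3ℚ :* δ′ ε :- con 0ℚ := (y :+ ε) :- (y :+ δ′ ε :+ (δ′ ε :+ δ′ ε :+ δ′ ε) :+ δ′ ε)) refl (seq y n) ε) ⟩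
    seq y n ℚ.+ ε                             ∎

≤-total-¬¬ : ∀ x y → ¬ ¬ (x ≤ y ⊎ y ≤ x)
≤-total-¬¬ x y h = h (inj₁ λ y<x → h (inj₂ λ x<y → <-asym x<y y<x))
  where
  <-asym : x < y → ¬ (y < x)
  <-asym (ε , 0<ε , x<y) (δ , 0<δ , y<x) with ev-∃ (ev-× x<y y<x)
  ... | n , x+ε≤y , y+δ≤x = ℚ.<-irrefl refl (ℚ.<-≤-trans (below (seq x n) 0<ε) (ℚ.≤-trans x+ε≤y
          (ℚ.≤-trans (ℚ.<⇒≤ (below (seq y n) 0<δ)) y+δ≤x)))
    where
    below : ∀ p {ε} → 0ℚ ℚ.< ε → p ℚ.< p ℚ.+ ε
    below p {ε} 0<ε = subst (ℚ._< p ℚ.+ ε) (ℚ.+-identityʳ p) (ℚ.+-monoʳ-< p 0<ε)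

≤-refl : ∀ x → x ≤ x
≤-refl x = ev-≤⇒≤ x x λ ε 0<ε → 0 , λ n _ → subst (ℚ._≤ seq x n ℚ.+ ε) (ℚ.+-identityʳ (seq x n))
  (ℚ.+-monoʳ-≤ (seq x n) (ℚ.<⇒≤ 0<ε))

fromℚ-mono-≤ : ∀ {p q} → p ℚ.≤ q → fromℚ p ≤ fromℚ q
fromℚ-mono-≤ {p} {q} p≤q = ev-≤⇒≤ (fromℚ p) (fromℚ q) λ ε 0<ε → 0 , λ n _ → ℚ.≤-trans p≤q
  (subst (ℚ._≤ q ℚ.+ ε) (ℚ.+-identityʳ q) (ℚ.+-monoʳ-≤ q (ℚ.<⇒≤ 0<ε)))

seq-^ : ∀ x q n → seq (x ^ q) n ≡ seq x n ^ᵠ q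
seq-^ x zero    n = refl
seq-^ x (suc q) n = cong (seq x n ℚ.*_) (seq-^ x q n)

-- The binary logarithm of a positive real

module Logarithm (x : ℝ) (0<x : 0ℝ < x) where

  private
    δ = proj₁ 0<x
    0<δ = proj₁ (proj₂ 0<x)

    δ≤x : Eventually λ n → δ ℚ.≤ seq x n
    δ≤x = ev-map (λ n → subst (ℚ._≤ seq x n) (ℚ.+-identityˡ δ)) (proj₂ (proj₂ 0<x))

    pos-x : Eventually λ n → 0ℚ ℚ.< seq x n
    pos-x = ev-map (λ n → ℚ.<-≤-trans 0<δ) δ≤x

    -- As the terms of x are at least δ, closeness up to δ * slack m is closeness up
    -- to the factor shrink m.
    close : ∀ m a b → δ ℚ.≤ b → ℚ.∣ b ℚ.- a ∣ ℚ.< δ ℚ.* slack m → b ℚ.* shrink m ℚ.≤ a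
    close m a b δ≤b h = ℚ.<⇒≤ (begin-strict
      b ℚ.* shrink m                    ≡⟨ solve 2 (λ b σ → b :* (con 1ℚ :- σ) := b :- b :* σ) refl b (slack m) ⟩
      b ℚ.- b ℚ.* slack m               ≤⟨ ≤-diff (*-monoʳ-≤ (slack m) (ℚ.<⇒≤ (0<slack m)) δ≤b) (solve 3 (λ b δ σ → b :* σ :- δ :* σ := (b :- δ :* σ) :- (b :- b :* σ)) refl b δ (slack m)) ⟩
      b ℚ.- δ ℚ.* slack m               <⟨ <-diff (∣p-q∣<r⇒p<q+r b a h) (solve 3 (λ a b d → (a :+ d) :- b := a :- (b :- d)) refl a b (δ ℚ.* slack m)) ⟩
      a                                 ∎)
      where
      open ℚ.≤-Reasoning
      open +-*-Solver

  -- The (m + 1)-st powers of the terms of x eventually stay in one window between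
  -- powers of two whose ratio is 8: they vary by a factor of at most 2 around
  -- the power of a single term, whose logarithm is located between integers.
  window : ∀ m → ∃ λ l → Eventually λ n →
    2^ l ℚ.≤ seq x n ^ᵠ suc m × seq x n ^ᵠ suc m ℚ.≤ 2^ (l ℤ.+ + 3)
  window m with cauchy x (δ ℚ.* slack (suc m)) (pos-* 0<δ (0<slack (suc m))) | δ≤x
  ... | N₁ , near | N₂ , δ≤xn = l , N , λ n N≤n →
    let xₙ  = seq x n
        δ≤xₙ = δ≤xn n (ℕ.≤-trans (ℕ.m≤n⊔m N₁ N₂) N≤n)
        N₁≤n = ℕ.≤-trans (ℕ.m≤m⊔n N₁ N₂) N≤n
    in ℚ.*-cancelˡ-≤-pos 2ℚ (begin
         2ℚ ℚ.* 2^ l                     ≡⟨ 2^-suc l ⟨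
         2^ (ℤ.suc l)                    ≡⟨ cong 2^ (ℤ.suc-pred k) ⟩
         2^ k                            ≤⟨ 2ᵏ≤ ⟩
         a ^ᵠ suc m                      ≤⟨ ℚ.<⇒≤ (shrink-^ (suc m) 0<a (close (suc m) xₙ a δ≤a (near N n (ℕ.m≤m⊔n N₁ N₂) N₁≤n))) ⟩
         2ℚ ℚ.* xₙ ^ᵠ suc m              ∎)
     , (begin
         xₙ ^ᵠ suc m                     ≤⟨ ℚ.<⇒≤ (shrink-^ (suc m) (ℚ.<-≤-trans 0<δ δ≤xₙ) (close (suc m) a xₙ δ≤xₙ (near n N N₁≤n (ℕ.m≤m⊔n N₁ N₂)))) ⟩
         2ℚ ℚ.* a ^ᵠ suc m               ≤⟨ *-monoˡ-≤ 2ℚ (ℚ.<⇒≤ (ℚ.positive⁻¹ 2ℚ)) (ℚ.<⇒≤ <2ᵏ) ⟩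
         2ℚ ℚ.* 2^ (ℤ.suc k)             ≡⟨ 2^-suc (ℤ.suc k) ⟨
         2^ (ℤ.suc (ℤ.suc k))            ≡⟨ cong 2^ top ⟩
         2^ (l ℤ.+ + 3)                  ∎)
    where
    open ℚ.≤-Reasoning
    N = N₁ ℕ.⊔ N₂
    a = seq x N
    δ≤a = δ≤xn N (ℕ.m≤n⊔m N₁ N₂)
    0<a = ℚ.<-≤-trans 0<δ δ≤a
    floor = floor-log₂ (a ^ᵠ suc m) (0<^ 0<a (suc m))
    k = proj₁ floor
    2ᵏ≤ = proj₁ (proj₂ floor)
    <2ᵏ = proj₂ (proj₂ floor)
    l = ℤ.pred k
    top : ℤ.suc (ℤ.suc k) ≡ l ℤ.+ + 3
    top = solve 1 (λ k → con (+ 1) :+ (con (+ 1) :+ k) := (con (ℤ.- (+ 1)) :+ k) :+ con (+ 3)) refl k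
      where open ℤ-Solver

  -- (m + 1) log₂ x lies between exponent m and exponent m + 3.
  exponent : ℕ → ℤ
  exponent m = proj₁ (window m)

  lower : ∀ m → Eventually λ n → 2^ (exponent m) ℚ.≤ seq x n ^ᵠ suc m
  lower m = let _ , N , h = window m in N , λ n N≤n → proj₁ (h n N≤n)

  upper : ∀ m → Eventually λ n → seq x n ^ᵠ suc m ℚ.≤ 2^ (exponent m ℤ.+ + 3)
  upper m = let _ , N , h = window m in N , λ n N≤n → proj₂ (h n N≤n)

  approx : ℕ → ℚ
  approx m = ι (exponent m) ℚ.* unit m

  upper-approx : ∀ m → ι (exponent m ℤ.+ + 3) ℚ.* unit m ≡ approx m ℚ.+ ιₙ 3 ℚ.* unit m
  upper-approx m = trans (cong (ℚ._* unit m) (ι-+ (exponent m) (+ 3)))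
    (ℚ.*-distribʳ-+ (unit m) (ι (exponent m)) (ιₙ 3))

  approx-near : ∀ m n → approx m ℚ.≤ approx n ℚ.+ ιₙ 3 ℚ.* unit n
  approx-near m n =
    let i , 0<xᵢ , lo , hi = ev-∃ (ev-× pos-x (ev-× (lower m) (upper n)))
    in subst (approx m ℚ.≤_) (upper-approx n)
         (cross-≤ (exponent m) (exponent n ℤ.+ + 3) m n (2^-cancel-≤ (begin
           2^ (exponent m ℤ.* + suc n)                    ≡⟨ 2^-^ (exponent m) (suc n) ⟨
           2^ (exponent m) ^ᵠ suc n                       ≤⟨ ^-mono-≤ (ℚ.<⇒≤ (0<2^ (exponent m))) lo (suc n) ⟩
           (seq x i ^ᵠ suc m) ^ᵠ suc n                    ≡⟨ ^-swap (seq x i) (suc m) (suc n) ⟩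
           (seq x i ^ᵠ suc n) ^ᵠ suc m                    ≤⟨ ^-mono-≤ (0≤^ (ℚ.<⇒≤ 0<xᵢ) (suc n)) hi (suc m) ⟩
           2^ (exponent n ℤ.+ + 3) ^ᵠ suc m               ≡⟨ 2^-^ (exponent n ℤ.+ + 3) (suc m) ⟩
           2^ ((exponent n ℤ.+ + 3) ℤ.* + suc m)          ∎)))
    where open ℚ.≤-Reasoning

  log₂ : ℝ
  log₂ = mkℝ approx λ ε 0<ε →
    let N , small = unit-small (ιₙ 3) ε 0<ε
        below : ∀ m n → N ℕ.≤ n → approx m ℚ.- approx n ℚ.< ε
        below m n N≤n = ℚ.≤-<-trans (p≤q+r⇒p-q≤r (approx-near m n)) (small n N≤n (0≤ιₙ 3))
    in N , λ m n N≤m N≤n → ∣p∣<q (below m n N≤n)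
         (subst (ℚ._< ε) (solve 2 (λ a b → b :- a := :- (a :- b)) refl (approx m) (approx n)) (below n m N≤m))
    where
    open +-*-Solver

  private
    root-window : ∀ n m q → seq (x ^ suc q) n ^ᵠ suc m ≡ (seq x n ^ᵠ suc m) ^ᵠ suc q
    root-window n m q = trans (cong (_^ᵠ suc m) (seq-^ x (suc q) n)) (^-swap (seq x n) (suc q) (suc m))

    pos-x^ : ∀ q → Eventually λ n → 0ℚ ℚ.< seq (x ^ q) n
    pos-x^ q = ev-map (λ n 0<xₙ → subst (0ℚ ℚ.<_) (sym (seq-^ x q n)) (0<^ 0<xₙ q)) pos-x

    below-log : ∀ r → fromℚ r < log₂ → fromℚ (2^ (ℚ.↥ r)) < x ^ ℚ.↧ₙ r
    below-log r (ε , 0<ε , r+ε≤log) = slack (suc m) ℚ.* 2^ p , pos-* (0<slack (suc m)) (0<2^ p) ,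
      ev-map step (ev-× (pos-x^ (suc q)) (lower m))
      where
      p = ℚ.↥ r
      q = ℚ.denominator-1 r
      m = proj₁ (ev-∃ r+ε≤log)
      r<approx : r ℚ.< approx m
      r<approx = ℚ.<-≤-trans (<-diff 0<ε (solve 2 (λ r ε → ε :- con 0ℚ := (r :+ ε) :- r) refl r ε)) (proj₂ (ev-∃ r+ε≤log))
        where open +-*-Solver
      pm<lq : p ℤ.* + suc m ℤ.< exponent m ℤ.* + suc q
      pm<lq = cross-< p (exponent m) q m (subst (ℚ._< approx m) (≡-fraction r) r<approx)
      step : ∀ n → 0ℚ ℚ.< seq (x ^ suc q) n × 2^ (exponent m) ℚ.≤ seq x n ^ᵠ suc m →
        2^ p ℚ.+ slack (suc m) ℚ.* 2^ p ℚ.≤ seq (x ^ suc q) n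
      step n (0<X , lo) = begin
        2^ p ℚ.+ slack (suc m) ℚ.* 2^ p          ≤⟨ ℚ.+-monoʳ-≤ (2^ p) (*-monoˡ-≤ (slack (suc m)) (ℚ.<⇒≤ (0<slack (suc m))) 2ᵖ≤X) ⟩
        2^ p ℚ.+ slack (suc m) ℚ.* X             ≤⟨ gap ⟩
        X                                        ∎
        where
        open ℚ.≤-Reasoning
        X = seq (x ^ suc q) n
        gap : 2^ p ℚ.+ slack (suc m) ℚ.* X ℚ.≤ X
        gap = gap⁺ (2^ p) X (suc m) (ℚ.<⇒≤ 0<X) (root-gap (2^ p) X (suc m) 0<X (begin
          2ℚ ℚ.* 2^ p ^ᵠ suc m                 ≡⟨ cong (2ℚ ℚ.*_) (2^-^ p (suc m)) ⟩
          2ℚ ℚ.* 2^ (p ℤ.* + suc m)            ≤⟨ 2^-double pm<lq ⟩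
          2^ (exponent m ℤ.* + suc q)          ≡⟨ 2^-^ (exponent m) (suc q) ⟨
          2^ (exponent m) ^ᵠ suc q             ≤⟨ ^-mono-≤ (ℚ.<⇒≤ (0<2^ (exponent m))) lo (suc q) ⟩
          (seq x n ^ᵠ suc m) ^ᵠ suc q          ≡⟨ root-window n m q ⟨
          X ^ᵠ suc m                           ∎))
        2ᵖ≤X : 2^ p ℚ.≤ X
        2ᵖ≤X = ℚ.≤-trans (subst (ℚ._≤ 2^ p ℚ.+ slack (suc m) ℚ.* X) (ℚ.+-identityʳ (2^ p))
          (ℚ.+-monoʳ-≤ (2^ p) (ℚ.<⇒≤ (pos-* (0<slack (suc m)) 0<X)))) gap

    above-log : ∀ r → log₂ < fromℚ r → x ^ ℚ.↧ₙ r < fromℚ (2^ (ℚ.↥ r))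
    above-log r (ε , 0<ε , log+ε≤r) = slack (suc m) ℚ.* 2^ p , pos-* (0<slack (suc m)) (0<2^ p) ,
      ev-map step (ev-× pos-x (upper m))
      where
      p = ℚ.↥ r
      q = ℚ.denominator-1 r
      N = proj₁ (unit-small (ιₙ 3) ε 0<ε)
      small = proj₂ (unit-small (ιₙ 3) ε 0<ε)
      m = N ℕ.⊔ proj₁ log+ε≤r
      approx<r : ι (exponent m ℤ.+ + 3) ℚ.* unit m ℚ.< r
      approx<r = begin-strict
        ι (exponent m ℤ.+ + 3) ℚ.* unit m      ≡⟨ upper-approx m ⟩
        approx m ℚ.+ ιₙ 3 ℚ.* unit m           <⟨ ℚ.+-monoʳ-< (approx m) (small m (ℕ.m≤m⊔n N (proj₁ log+ε≤r)) (0≤ιₙ 3)) ⟩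
        approx m ℚ.+ ε                         ≤⟨ proj₂ log+ε≤r m (ℕ.m≤n⊔m N (proj₁ log+ε≤r)) ⟩
        r                                      ∎
        where open ℚ.≤-Reasoning
      lq<pm : (exponent m ℤ.+ + 3) ℤ.* + suc q ℤ.< p ℤ.* + suc m
      lq<pm = cross-< (exponent m ℤ.+ + 3) p m q (subst (ι (exponent m ℤ.+ + 3) ℚ.* unit m ℚ.<_) (≡-fraction r) approx<r)
      step : ∀ n → 0ℚ ℚ.< seq x n × seq x n ^ᵠ suc m ℚ.≤ 2^ (exponent m ℤ.+ + 3) →
        seq (x ^ suc q) n ℚ.+ slack (suc m) ℚ.* 2^ p ℚ.≤ 2^ p
      step n (0<xₙ , hi) = gap⁺ (seq (x ^ suc q) n) (2^ p) (suc m) (ℚ.<⇒≤ (0<2^ p)) (root-gap (seq (x ^ suc q) n) (2^ p) (suc m) (0<2^ p) (begin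
        2ℚ ℚ.* seq (x ^ suc q) n ^ᵠ suc m                    ≡⟨ cong (2ℚ ℚ.*_) (root-window n m q) ⟩
        2ℚ ℚ.* (seq x n ^ᵠ suc m) ^ᵠ suc q                   ≤⟨ *-monoˡ-≤ 2ℚ (ℚ.<⇒≤ (ℚ.positive⁻¹ 2ℚ)) (^-mono-≤ (0≤^ (ℚ.<⇒≤ 0<xₙ) (suc m)) hi (suc q)) ⟩
        2ℚ ℚ.* 2^ (exponent m ℤ.+ + 3) ^ᵠ suc q              ≡⟨ cong (2ℚ ℚ.*_) (2^-^ (exponent m ℤ.+ + 3) (suc q)) ⟩
        2ℚ ℚ.* 2^ ((exponent m ℤ.+ + 3) ℤ.* + suc q)         ≤⟨ 2^-double lq<pm ⟩
        2^ (p ℤ.* + suc m)                                   ≡⟨ 2^-^ p (suc m) ⟨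
        2^ p ^ᵠ suc m                                        ∎))
        where open ℚ.≤-Reasoning

  isLog₂ : IsLog₂ x log₂
  isLog₂ = below-log , above-log

-- Counting in windows of natural numbers

-- The sum of f over the window [a, a + L).
∑ : (ℕ → ℕ) → ℕ → ℕ → ℕ
∑ f a zero    = 0
∑ f a (suc L) = f a ℕ.+ ∑ f (suc a) L

[_] : Bool → ℕ
[ true  ] = 1
[ false ] = 0

-- The number of elements of S in the window [a, a + L).
count : (ℕ → Bool) → ℕ → ℕ → ℕ
count S = ∑ λ k → [ S k ]

∑-mono : ∀ {f g} → (∀ k → f k ℕ.≤ g k) → ∀ a L → ∑ f a L ℕ.≤ ∑ g a L
∑-mono f≤g a zero    = ℕ.z≤n
∑-mono f≤g a (suc L) = ℕ.+-mono-≤ (f≤g a) (∑-mono f≤g (suc a) L)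

∑-cong : ∀ {f g} → (∀ k → f k ≡ g k) → ∀ a L → ∑ f a L ≡ ∑ g a L
∑-cong f≡g a zero    = refl
∑-cong f≡g a (suc L) = cong₂ ℕ._+_ (f≡g a) (∑-cong f≡g (suc a) L)

∑-++ : ∀ f a L M → ∑ f a (L ℕ.+ M) ≡ ∑ f a L ℕ.+ ∑ f (a ℕ.+ L) M
∑-++ f a zero    M = cong (λ b → ∑ f b M) (sym (ℕ.+-identityʳ a))
∑-++ f a (suc L) M = begin
  f a ℕ.+ ∑ f (suc a) (L ℕ.+ M)                            ≡⟨ cong (f a ℕ.+_) (∑-++ f (suc a) L M) ⟩
  f a ℕ.+ (∑ f (suc a) L ℕ.+ ∑ f (suc a ℕ.+ L) M)          ≡⟨ ℕ.+-assoc (f a) _ _ ⟨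
  ∑ f a (suc L) ℕ.+ ∑ f (suc a ℕ.+ L) M                    ≡⟨ cong (λ b → ∑ f a (suc L) ℕ.+ ∑ f b M) (ℕ.+-suc a L) ⟨
  ∑ f a (suc L) ℕ.+ ∑ f (a ℕ.+ suc L) M                    ∎
  where open ≡-Reasoning

∑-last : ∀ f a L → ∑ f a (suc L) ≡ ∑ f a L ℕ.+ f (a ℕ.+ L)
∑-last f a L = trans (cong (∑ f a) (ℕ.+-comm 1 L))
  (trans (∑-++ f a L 1) (cong (∑ f a L ℕ.+_) (ℕ.+-identityʳ (f (a ℕ.+ L)))))

∑-mono-length : ∀ f a {L M} → L ℕ.≤ M → ∑ f a L ℕ.≤ ∑ f a M
∑-mono-length f a ℕ.z≤n       = ℕ.z≤n
∑-mono-length f a (ℕ.s≤s L≤M) = ℕ.+-monoʳ-≤ (f a) (∑-mono-length f (suc a) L≤M)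

∑-const : ∀ f a c L → (∀ i → i ℕ.< L → f (a ℕ.+ i) ≡ c) → ∑ f a L ≡ L ℕ.* c
∑-const f a c zero    f≡c = refl
∑-const f a c (suc L) f≡c = cong₂ ℕ._+_
  (trans (cong f (sym (ℕ.+-identityʳ a))) (f≡c 0 (ℕ.s≤s ℕ.z≤n)))
  (∑-const f (suc a) c L λ i i<L → trans (cong f (sym (ℕ.+-suc a i))) (f≡c (suc i) (ℕ.s≤s i<L)))

∑-+ : ∀ f g a L → ∑ (λ k → f k ℕ.+ g k) a L ≡ ∑ f a L ℕ.+ ∑ g a L
∑-+ f g a zero    = refl
∑-+ f g a (suc L) = trans (cong (f a ℕ.+ g a ℕ.+_) (∑-+ f g (suc a) L))
  (solve 4 (λ p q r s → (p :+ q) :+ (r :+ s) := (p :+ r) :+ (q :+ s)) refl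
    (f a) (g a) (∑ f (suc a) L) (∑ g (suc a) L))
  where open ℕ-Solver

∑-*ˡ : ∀ c f a L → ∑ (λ k → c ℕ.* f k) a L ≡ c ℕ.* ∑ f a L
∑-*ˡ c f a zero    = sym (ℕ.*-zeroʳ c)
∑-*ˡ c f a (suc L) = trans (cong (c ℕ.* f a ℕ.+_) (∑-*ˡ c f (suc a) L)) (sym (ℕ.*-distribˡ-+ c (f a) _))

∑-swap : ∀ (h : ℕ → ℕ → ℕ) a L b M →
  ∑ (λ x → ∑ (h x) b M) a L ≡ ∑ (λ k → ∑ (λ x → h x k) a L) b M
∑-swap h a zero    b M = sym (trans (∑-const (λ _ → 0) b 0 M λ _ _ → refl) (ℕ.*-zeroʳ M))
∑-swap h a (suc L) b M = trans (cong (∑ (h a) b M ℕ.+_) (∑-swap h (suc a) L b M))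
  (sym (∑-+ (h a) (λ k → ∑ (λ x → h x k) (suc a) L) b M))

∑-shift : ∀ f a b L → ∑ (λ x → f (a ℕ.+ x)) b L ≡ ∑ f (a ℕ.+ b) L
∑-shift f a b zero    = refl
∑-shift f a b (suc L) = cong (f (a ℕ.+ b) ℕ.+_)
  (trans (∑-shift f a (suc b) L) (cong (λ c → ∑ f c L) (ℕ.+-suc a b)))

term≤∑ : ∀ f a i {L} → i ℕ.< L → f (a ℕ.+ i) ℕ.≤ ∑ f a L
term≤∑ f a zero    {suc L} _           = subst (λ b → f b ℕ.≤ ∑ f a (suc L)) (sym (ℕ.+-identityʳ a)) (ℕ.m≤m+n (f a) _)
term≤∑ f a (suc i) {suc L} (ℕ.s≤s i<L) = ℕ.≤-trans
  (subst (λ b → f b ℕ.≤ ∑ f (suc a) L) (sym (ℕ.+-suc a i)) (term≤∑ f (suc a) i i<L))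
  (ℕ.m≤n+m _ (f a))

-- Some term is at least the average.
pigeonhole : ∀ f a L → ∃ λ x → ∑ f a (suc L) ℕ.≤ suc L ℕ.* f x
pigeonhole f a zero    = a , ℕ.≤-refl
pigeonhole f a (suc L) with pigeonhole f (suc a) L
... | x , avg with ℕ.≤-total (f a) (f x)
...   | inj₁ fa≤fx = x , ℕ.+-mono-≤ fa≤fx avg
...   | inj₂ fx≤fa = a , ℕ.+-monoʳ-≤ (f a) (ℕ.≤-trans avg (ℕ.*-monoʳ-≤ (suc L) fx≤fa))

∑-periodic : ∀ g P → (∀ a → g (a ℕ.+ P) ≡ g a) → ∀ a → ∑ g a P ≡ ∑ g 0 P
∑-periodic g P per zero    = refl
∑-periodic g P per (suc a) = trans (ℕ.+-cancelˡ-≡ (g a) _ _ shift) (∑-periodic g P per a)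
  where
  shift : g a ℕ.+ ∑ g (suc a) P ≡ g a ℕ.+ ∑ g a P
  shift = trans (∑-last g a P) (trans (cong (∑ g a P ℕ.+_) (per a)) (ℕ.+-comm _ (g a)))

-- The set of the y whose residue modulo P lies in the arc [0, A).
arc : ∀ P .{{_ : ℕ.NonZero P}} → ℕ → ℕ → Bool
arc P A y = (y ℕ.% P) ℕ.<ᵇ A

<⇒<ᵇ≡true : ∀ {m n} → m ℕ.< n → (m ℕ.<ᵇ n) ≡ true
<⇒<ᵇ≡true m<n = Equivalence.to T-≡ (ℕ.<⇒<ᵇ m<n)

<ᵇ≡true⇒< : ∀ {m n} → (m ℕ.<ᵇ n) ≡ true → m ℕ.< n
<ᵇ≡true⇒< {m} {n} eq = ℕ.<ᵇ⇒< m n (Equivalence.from T-≡ eq)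

≥⇒<ᵇ≡false : ∀ {m n} → n ℕ.≤ m → (m ℕ.<ᵇ n) ≡ false
≥⇒<ᵇ≡false {m} {n} n≤m with m ℕ.<ᵇ n in eq
... | false = refl
... | true  = ⊥-elim (ℕ.<⇒≱ (<ᵇ≡true⇒< eq) n≤m)

count-arc : ∀ P A .{{_ : ℕ.NonZero P}} → A ℕ.≤ P → ∀ a → count (arc P A) a P ≡ A
count-arc P A A≤P a = begin
  count (arc P A) a P                                             ≡⟨ ∑-periodic (λ y → [ arc P A y ]) P (λ y → cong (λ r → [ r ℕ.<ᵇ A ]) (ℕ.[m+n]%n≡m%n y P)) a ⟩
  count (arc P A) 0 P                                             ≡⟨ cong (count (arc P A) 0) (ℕ.m+[n∸m]≡n A≤P) ⟨
  count (arc P A) 0 (A ℕ.+ (P ℕ.∸ A))                             ≡⟨ ∑-++ (λ y → [ arc P A y ]) 0 A (P ℕ.∸ A) ⟩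
  count (arc P A) 0 A ℕ.+ count (arc P A) A (P ℕ.∸ A)             ≡⟨ cong₂ ℕ._+_ (∑-const _ 0 1 A inside) (∑-const _ A 0 (P ℕ.∸ A) outside) ⟩
  A ℕ.* 1 ℕ.+ (P ℕ.∸ A) ℕ.* 0                                     ≡⟨ cong₂ ℕ._+_ (ℕ.*-identityʳ A) (ℕ.*-zeroʳ (P ℕ.∸ A)) ⟩
  A ℕ.+ 0                                                         ≡⟨ ℕ.+-identityʳ A ⟩
  A                                                               ∎
  where
  open ≡-Reasoning
  inside : ∀ i → i ℕ.< A → [ arc P A i ] ≡ 1
  inside i i<A = cong [_] (trans (cong (ℕ._<ᵇ A) (ℕ.m<n⇒m%n≡m (ℕ.<-≤-trans i<A A≤P))) (<⇒<ᵇ≡true i<A))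
  outside : ∀ i → i ℕ.< P ℕ.∸ A → [ arc P A (A ℕ.+ i) ] ≡ 0
  outside i i<P-A = cong [_] (trans
    (cong (ℕ._<ᵇ A) (ℕ.m<n⇒m%n≡m (subst (A ℕ.+ i ℕ.<_) (ℕ.m+[n∸m]≡n A≤P) (ℕ.+-monoʳ-< A i<P-A))))
    (≥⇒<ᵇ≡false (ℕ.m≤m+n A i)))

[∧] : ∀ b c → [ b ∧ c ] ≡ [ b ] ℕ.* [ c ]
[∧] true  c = sym (ℕ.+-identityʳ [ c ])
[∧] false c = refl

[∨] : ∀ b c → (b ≡ true → c ≡ false) → [ b ] ℕ.+ [ c ] ℕ.≤ [ b ∨ c ]
[∨] true  c h = ℕ.≤-reflexive (cong (λ c → 1 ℕ.+ [ c ]) (h refl))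
[∨] false c h = ℕ.≤-refl

-- Averaging over the rotations of an arc: some rotation keeps at least the
-- proportion A / P of the elements of S.
averaging : ∀ S (r : ℕ → ℕ) P A .{{_ : ℕ.NonZero P}} → A ℕ.≤ P → ∀ L →
  ∃ λ x → A ℕ.* count S 0 L ℕ.≤ P ℕ.* count (λ k → S k ∧ arc P A (r k ℕ.+ x)) 0 L
averaging S r P@(suc P-1) A A≤P L with pigeonhole (λ x → count (λ k → S k ∧ arc P A (r k ℕ.+ x)) 0 L) 0 P-1
... | x , avg = x , subst (ℕ._≤ P ℕ.* count (λ k → S k ∧ arc P A (r k ℕ.+ x)) 0 L) total avg
  where
  open ≡-Reasoning
  hit : ℕ → ℕ → ℕ
  hit x k = [ S k ∧ arc P A (r k ℕ.+ x) ]

  rotations : ∀ k → ∑ (λ x → hit x k) 0 P ≡ A ℕ.* [ S k ]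
  rotations k = begin
    ∑ (λ x → hit x k) 0 P                                      ≡⟨ ∑-cong (λ x → [∧] (S k) _) 0 P ⟩
    ∑ (λ x → [ S k ] ℕ.* [ arc P A (r k ℕ.+ x) ]) 0 P          ≡⟨ ∑-*ˡ [ S k ] _ 0 P ⟩
    [ S k ] ℕ.* ∑ (λ x → [ arc P A (r k ℕ.+ x) ]) 0 P          ≡⟨ cong ([ S k ] ℕ.*_) (trans (∑-shift (λ y → [ arc P A y ]) (r k) 0 P) (cong (λ a → count (arc P A) a P) (ℕ.+-identityʳ (r k)))) ⟩
    [ S k ] ℕ.* count (arc P A) (r k) P                        ≡⟨ cong ([ S k ] ℕ.*_) (count-arc P A A≤P (r k)) ⟩
    [ S k ] ℕ.* A                                              ≡⟨ ℕ.*-comm [ S k ] A ⟩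
    A ℕ.* [ S k ]                                              ∎

  total : ∑ (λ x → ∑ (hit x) 0 L) 0 P ≡ A ℕ.* count S 0 L
  total = trans (∑-swap hit 0 P 0 L) (trans (∑-cong rotations 0 L) (∑-*ˡ A _ 0 L))

-- The density of sets of natural numbers avoiding dyadic ranges of differences

-- No two elements of S differ by between T and 2 T.
Avoids : (ℕ → Bool) → ℕ → Set
Avoids S T = ∀ k t → T ℕ.≤ t → t ℕ.≤ T ℕ.+ T → S k ≡ true → S (k ℕ.+ t) ≡ true → ⊥

count-double : ∀ S T c b → (∀ a → count S a T ℕ.* c ℕ.≤ b) → ∀ a → count S a (T ℕ.+ T) ℕ.* c ℕ.≤ b ℕ.+ b
count-double S T c b h a = subst (ℕ._≤ b ℕ.+ b)
  (trans (sym (ℕ.*-distribʳ-+ c (count S a T) _)) (cong (ℕ._* c) (sym (∑-++ (λ k → [ S k ]) a T T))))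
  (ℕ.+-mono-≤ (h a) (h (a ℕ.+ T)))

-- If S avoids the differences between T and 2 T, then its elements in a window
-- of length 2 T lie in the window of length T that starts at the first of them.
count-avoid : ∀ S T → Avoids S T → ∀ c b → (∀ a → count S a T ℕ.* c ℕ.≤ b) →
  ∀ a → count S a (T ℕ.+ T) ℕ.* c ℕ.≤ b
count-avoid S T avoid c b h a = go a (T ℕ.+ T) ℕ.≤-refl
  where
  go : ∀ a L → L ℕ.≤ T ℕ.+ T → count S a L ℕ.* c ℕ.≤ b
  go a zero    _   = ℕ.z≤n
  go a (suc L) L<2T with S a in Sa
  ... | false = go (suc a) L (ℕ.<⇒≤ L<2T)
  ... | true  = begin
    suc (count S (suc a) L) ℕ.* c                        ≡⟨ cong (λ i → (i ℕ.+ count S (suc a) L) ℕ.* c) (cong [_] Sa) ⟨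
    count S a (suc L) ℕ.* c                              ≤⟨ ℕ.*-monoˡ-≤ c (∑-mono-length (λ k → [ S k ]) a L<2T) ⟩
    count S a (T ℕ.+ T) ℕ.* c                            ≡⟨ cong (ℕ._* c) (∑-++ (λ k → [ S k ]) a T T) ⟩
    (count S a T ℕ.+ count S (a ℕ.+ T) T) ℕ.* c          ≡⟨ cong (λ i → (count S a T ℕ.+ i) ℕ.* c) (trans (∑-const _ (a ℕ.+ T) 0 T far) (ℕ.*-zeroʳ T)) ⟩
    (count S a T ℕ.+ 0) ℕ.* c                            ≡⟨ cong (ℕ._* c) (ℕ.+-identityʳ (count S a T)) ⟩
    count S a T ℕ.* c                                    ≤⟨ h a ⟩
    b                                                    ∎
    where
    open ℕ.≤-Reasoning
    far : ∀ i → i ℕ.< T → [ S (a ℕ.+ T ℕ.+ i) ] ≡ 0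
    far i i<T with S (a ℕ.+ T ℕ.+ i) in eq
    ... | false = refl
    ... | true  = ⊥-elim (avoid a (T ℕ.+ i) (ℕ.m≤m+n T i) (ℕ.+-monoʳ-≤ T (ℕ.<⇒≤ i<T)) Sa
      (trans (cong S (sym (ℕ.+-assoc a T i))) eq))

2^suc : ∀ n → 2 ℕ.^ suc n ≡ 2 ℕ.^ n ℕ.+ 2 ℕ.^ n
2^suc n = cong (2 ℕ.^ n ℕ.+_) (ℕ.+-identityʳ (2 ℕ.^ n))

-- E marks scales m at which S avoids the differences between 2 ^ m and 2 ^ (m + 1);
-- each of them halves the bound on the number of elements of S in a window.
density : ∀ S (E : ℕ → Bool) N → (∀ m → m ℕ.< N → E m ≡ true → Avoids S (2 ℕ.^ m)) →
  ∀ m → m ℕ.≤ N → ∀ a → count S a (2 ℕ.^ m) ℕ.* 2 ℕ.^ count E 0 m ℕ.≤ 2 ℕ.^ m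
density S E N avoid zero    _   a with S a
... | true  = ℕ.≤-refl
... | false = ℕ.z≤n
density S E N avoid (suc m) m<N a rewrite ∑-last (λ k → [ E k ]) 0 m | 2^suc m with E m in Em
... | false = subst (λ e → count S a (2 ℕ.^ m ℕ.+ 2 ℕ.^ m) ℕ.* 2 ℕ.^ e ℕ.≤ 2 ℕ.^ m ℕ.+ 2 ℕ.^ m)
  (sym (ℕ.+-identityʳ (count E 0 m)))
  (count-double S (2 ℕ.^ m) (2 ℕ.^ count E 0 m) (2 ℕ.^ m) (density S E N avoid m (ℕ.<⇒≤ m<N)) a)
... | true  = subst (ℕ._≤ 2 ℕ.^ m ℕ.+ 2 ℕ.^ m) regroup
  (ℕ.+-mono-≤ half half)
  where
  c = 2 ℕ.^ count E 0 m
  w = count S a (2 ℕ.^ m ℕ.+ 2 ℕ.^ m)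
  half : w ℕ.* c ℕ.≤ 2 ℕ.^ m
  half = count-avoid S (2 ℕ.^ m) (avoid m m<N Em) c (2 ℕ.^ m) (density S E N avoid m (ℕ.<⇒≤ m<N)) a
  regroup : w ℕ.* c ℕ.+ w ℕ.* c ≡ w ℕ.* 2 ℕ.^ (count E 0 m ℕ.+ 1)
  regroup = trans (sym (ℕ.*-distribˡ-+ w c c))
    (cong (w ℕ.*_) (trans (sym (2^suc (count E 0 m))) (cong (2 ℕ.^_) (ℕ.+-comm 1 (count E 0 m)))))

-- The scale that belongs to j is m = N - 1 - j, which is why the entries of the list
-- are counted from the top.
length≤count : ∀ N xs → Unique xs → All (ℕ._< N) xs →
  length xs ℕ.≤ count (λ m → does (N ℕ.∸ suc m ∈? xs)) 0 N
length≤count N []       _            _            = ℕ.z≤n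
length≤count N (y ∷ ys) (y∉ys ∷ ys!) (y<N ∷ ys<N) = begin
  1 ℕ.+ length ys                                       ≤⟨ ℕ.+-mono-≤ hit (length≤count N ys ys! ys<N) ⟩
  ∑ isY 0 N ℕ.+ ∑ isYs 0 N                              ≡⟨ ∑-+ isY isYs 0 N ⟨
  ∑ (λ m → isY m ℕ.+ isYs m) 0 N                        ≤⟨ ∑-mono split 0 N ⟩
  count (λ m → does (N ℕ.∸ suc m ∈? (y ∷ ys))) 0 N      ∎
  where
  open ℕ.≤-Reasoning
  isY isYs : ℕ → ℕ
  isY  m = [ does (N ℕ.∸ suc m ℕ.≟ y) ]
  isYs m = [ does (N ℕ.∸ suc m ∈? ys) ]
  hit : 1 ℕ.≤ ∑ isY 0 N
  hit = subst (ℕ._≤ ∑ isY 0 N) (cong [_] (dec-true (N ℕ.∸ suc (N ℕ.∸ suc y) ℕ.≟ y) reverse-reverse))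
    (term≤∑ isY 0 (N ℕ.∸ suc y) (ℕ.∸-monoʳ-< (ℕ.s≤s ℕ.z≤n) y<N))
    where
    reverse-reverse : N ℕ.∸ suc (N ℕ.∸ suc y) ≡ y
    reverse-reverse = trans (sym (ℕ.pred[m∸n]≡m∸[1+n] N (N ℕ.∸ suc y))) (cong ℕ.pred (ℕ.m∸[m∸n]≡n y<N))
  split : ∀ m → isY m ℕ.+ isYs m ℕ.≤ [ does (N ℕ.∸ suc m ∈? (y ∷ ys)) ]
  split m = [∨] (does (N ℕ.∸ suc m ℕ.≟ y)) _ λ eq → dec-false (N ℕ.∸ suc m ∈? ys) λ ∈ys →
    All.lookup y∉ys ∈ys (sym (ℕ.≡ᵇ⇒≡ (N ℕ.∸ suc m) y (Equivalence.from T-≡ eq)))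

-- Times of simultaneous return to the integer lattice

-- p lies within s of an integer.
NearInteger : ℚ → ℚ → Set
NearInteger s p = ∃ λ z → ℚ.∣ p ℚ.- ι z ∣ ℚ.≤ s

∧-true : ∀ {b c} → b ∧ c ≡ true → b ≡ true × c ≡ true
∧-true {true} {true} _ = refl , refl

module _ (u s : ℚ) (0≤s : 0ℚ ℚ.≤ s) (s≤1 : s ℚ.≤ 1ℚ) where

  private
    -- P is a common denominator, u = C / P and s = A / P; modulo 1, the multiple k u is
    -- k c / P.
    P A : ℕ
    P = ℚ.↧ₙ u ℕ.* ℚ.↧ₙ s
    A = ℤ.∣ ℚ.↥ s ∣ ℕ.* ℚ.↧ₙ u

    C e : ℤ
    C = ℚ.↥ u ℤ.* + (ℚ.↧ₙ s)
    e = C ℤ./ℕ P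

    c : ℕ
    c = C ℤ.%ℕ P

    0<P : 0ℚ ℚ.< ιₙ P
    0<P = 0<ιₙ (ℕ.s≤s ℕ.z≤n)

    uP≡C : u ℚ.* ιₙ P ≡ ι C
    uP≡C = begin
      u ℚ.* ιₙ P                                      ≡⟨ cong (u ℚ.*_) (ιₙ-* (ℚ.↧ₙ u) (ℚ.↧ₙ s)) ⟩
      u ℚ.* (ιₙ (ℚ.↧ₙ u) ℚ.* ιₙ (ℚ.↧ₙ s))             ≡⟨ ℚ.*-assoc u (ιₙ (ℚ.↧ₙ u)) (ιₙ (ℚ.↧ₙ s)) ⟨
      u ℚ.* ιₙ (ℚ.↧ₙ u) ℚ.* ιₙ (ℚ.↧ₙ s)               ≡⟨ cong (ℚ._* ιₙ (ℚ.↧ₙ s)) (↥-↧ u) ⟩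
      ι (ℚ.↥ u) ℚ.* ιₙ (ℚ.↧ₙ s)                       ≡⟨ ι-* (ℚ.↥ u) (+ (ℚ.↧ₙ s)) ⟨
      ι C                                             ∎
      where open ≡-Reasoning

    sP≡A : s ℚ.* ιₙ P ≡ ιₙ A
    sP≡A = begin
      s ℚ.* ιₙ P                                      ≡⟨ cong (s ℚ.*_) (trans (cong ιₙ (ℕ.*-comm (ℚ.↧ₙ u) (ℚ.↧ₙ s))) (ιₙ-* (ℚ.↧ₙ s) (ℚ.↧ₙ u))) ⟩
      s ℚ.* (ιₙ (ℚ.↧ₙ s) ℚ.* ιₙ (ℚ.↧ₙ u))             ≡⟨ ℚ.*-assoc s (ιₙ (ℚ.↧ₙ s)) (ιₙ (ℚ.↧ₙ u)) ⟨
      s ℚ.* ιₙ (ℚ.↧ₙ s) ℚ.* ιₙ (ℚ.↧ₙ u)               ≡⟨ cong (ℚ._* ιₙ (ℚ.↧ₙ u)) (↥-↧ s) ⟩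
      ι (ℚ.↥ s) ℚ.* ιₙ (ℚ.↧ₙ u)                       ≡⟨ cong (λ i → ι i ℚ.* ιₙ (ℚ.↧ₙ u)) (ℤ.0≤i⇒+∣i∣≡i 0≤↥s) ⟨
      ιₙ ℤ.∣ ℚ.↥ s ∣ ℚ.* ιₙ (ℚ.↧ₙ u)                  ≡⟨ ιₙ-* ℤ.∣ ℚ.↥ s ∣ (ℚ.↧ₙ u) ⟨
      ιₙ A                                            ∎
      where
      open ≡-Reasoning
      0≤↥s : + 0 ℤ.≤ ℚ.↥ s
      0≤↥s = ι-cancel-≤ (subst₂ ℚ._≤_ (sym ι0≡0) (↥-↧ s) (*-nonNeg 0≤s (0≤ιₙ (ℚ.↧ₙ s))))

    A≤P : A ℕ.≤ P
    A≤P = ℤ.drop‿+≤+ (ι-cancel-≤ (subst₂ ℚ._≤_ sP≡A (ℚ.*-identityˡ (ιₙ P)) (*-monoʳ-≤ (ιₙ P) (ℚ.<⇒≤ 0<P) s≤1)))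

    -- Two residues in the arc [0, A) differ by at most A.
    residues-near : ∀ {r r′} → r ℕ.< A → r′ ℕ.< A → ℚ.∣ ιₙ r′ ℚ.- ιₙ r ∣ ℚ.≤ ιₙ A
    residues-near {r} {r′} r<A r′<A = ∣p∣≤q (bound r r′<A)
      (subst (ℚ._≤ ιₙ A) (solve 2 (λ a b → a :- b := :- (b :- a)) refl (ιₙ r) (ιₙ r′)) (bound r′ r<A))
      where
      open +-*-Solver
      bound : ∀ r {r′} → r′ ℕ.< A → ιₙ r′ ℚ.- ιₙ r ℚ.≤ ιₙ A
      bound r r′<A = p≤q+r⇒p-q≤r (ℚ.≤-trans (ιₙ-mono-≤ (ℕ.<⇒≤ r′<A))
        (subst (ℚ._≤ ιₙ r ℚ.+ ιₙ A) (ℚ.+-identityˡ (ιₙ A)) (ℚ.+-monoˡ-≤ (ιₙ A) (0≤ιₙ r))))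

    -- If k u and (k + t) u, both rotated by x / P, lie in the arc [0, s) modulo 1, then
    -- their difference t u is within s of an integer.
    return : ∀ x k t → arc P A (k ℕ.* c ℕ.+ x) ≡ true → arc P A ((k ℕ.+ t) ℕ.* c ℕ.+ x) ≡ true →
      NearInteger s (ιₙ t ℚ.* u)
    return x k t in₁ in₂ = z , *-cancelʳ-≤ (ιₙ P) 0<P (begin
      ℚ.∣ ιₙ t ℚ.* u ℚ.- ι z ∣ ℚ.* ιₙ P               ≡⟨ cong (ℚ.∣ ιₙ t ℚ.* u ℚ.- ι z ∣ ℚ.*_) (ℚ.0≤p⇒∣p∣≡p (ℚ.<⇒≤ 0<P)) ⟨
      ℚ.∣ ιₙ t ℚ.* u ℚ.- ι z ∣ ℚ.* ℚ.∣ ιₙ P ∣         ≡⟨ ℚ.∣p*q∣≡∣p∣*∣q∣ (ιₙ t ℚ.* u ℚ.- ι z) (ιₙ P) ⟨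
      ℚ.∣ (ιₙ t ℚ.* u ℚ.- ι z) ℚ.* ιₙ P ∣             ≡⟨ cong ℚ.∣_∣ difference ⟩
      ℚ.∣ ιₙ (y′ ℕ.% P) ℚ.- ιₙ (y ℕ.% P) ∣            ≤⟨ residues-near (<ᵇ≡true⇒< in₁) (<ᵇ≡true⇒< in₂) ⟩
      ιₙ A                                            ≡⟨ sP≡A ⟨
      s ℚ.* ιₙ P                                      ∎)
      where
      open ℚ.≤-Reasoning
      y y′ : ℕ
      y  = k ℕ.* c ℕ.+ x
      y′ = (k ℕ.+ t) ℕ.* c ℕ.+ x
      z : ℤ
      z = (+ (y′ ℕ./ P) ℤ.- + (y ℕ./ P)) ℤ.+ + t ℤ.* e

      divide : ∀ y → ιₙ y ≡ ιₙ (y ℕ.% P) ℚ.+ ιₙ (y ℕ./ P) ℚ.* ιₙ P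
      divide y = trans (cong ιₙ (ℕ.m≡m%n+[m/n]*n y P))
        (trans (ιₙ-+ (y ℕ.% P) (y ℕ./ P ℕ.* P)) (cong (ιₙ (y ℕ.% P) ℚ.+_) (ιₙ-* (y ℕ./ P) P)))

      ιC : ι C ≡ ιₙ c ℚ.+ ι e ℚ.* ιₙ P
      ιC = trans (cong ι (ℤ.a≡a%ℕn+[a/ℕn]*n C P))
        (trans (ι-+ (+ c) (e ℤ.* + P)) (cong (ιₙ c ℚ.+_) (ι-* e (+ P))))

      ιz : ι z ≡ (ιₙ (y′ ℕ./ P) ℚ.- ιₙ (y ℕ./ P)) ℚ.+ ιₙ t ℚ.* ι e
      ιz = trans (ι-+ _ (+ t ℤ.* e)) (cong₂ ℚ._+_ (ι-- (+ (y′ ℕ./ P)) (+ (y ℕ./ P))) (ι-* (+ t) e))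

      ιy : ∀ k → ιₙ (k ℕ.* c ℕ.+ x) ≡ ιₙ k ℚ.* ιₙ c ℚ.+ ιₙ x
      ιy k = trans (ιₙ-+ (k ℕ.* c) x) (cong (ℚ._+ ιₙ x) (ιₙ-* k c))

      steps : ιₙ t ℚ.* ιₙ c ≡ ιₙ y′ ℚ.- ιₙ y
      steps = sym (trans (cong₂ ℚ._-_ (trans (ιy (k ℕ.+ t)) (cong (λ q → q ℚ.* ιₙ c ℚ.+ ιₙ x) (ιₙ-+ k t))) (ιy k))
        (solve 4 (λ k t c x → ((k :+ t) :* c :+ x) :- (k :* c :+ x) := t :* c) refl (ιₙ k) (ιₙ t) (ιₙ c) (ιₙ x)))
        where open +-*-Solver

      difference : (ιₙ t ℚ.* u ℚ.- ι z) ℚ.* ιₙ P ≡ ιₙ (y′ ℕ.% P) ℚ.- ιₙ (y ℕ.% P)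
      difference = begin-equality
        (ιₙ t ℚ.* u ℚ.- ι z) ℚ.* ιₙ P
          ≡⟨ solve 4 (λ t u z P → (t :* u :- z) :* P := t :* (u :* P) :- z :* P) refl (ιₙ t) u (ι z) (ιₙ P) ⟩
        ιₙ t ℚ.* (u ℚ.* ιₙ P) ℚ.- ι z ℚ.* ιₙ P
          ≡⟨ cong₂ (λ a b → ιₙ t ℚ.* a ℚ.- b ℚ.* ιₙ P) (trans uP≡C ιC) ιz ⟩
        ιₙ t ℚ.* (ιₙ c ℚ.+ ι e ℚ.* ιₙ P) ℚ.- ((q′ ℚ.- q) ℚ.+ ιₙ t ℚ.* ι e) ℚ.* ιₙ P
          ≡⟨ solve 6 (λ t c e P q′ q → t :* (c :+ e :* P) :- ((q′ :- q) :+ t :* e) :* P := t :* c :- (q′ :- q) :* P) refl (ιₙ t) (ιₙ c) (ι e) (ιₙ P) q′ q ⟩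
        ιₙ t ℚ.* ιₙ c ℚ.- (q′ ℚ.- q) ℚ.* ιₙ P
          ≡⟨ cong (ℚ._- (q′ ℚ.- q) ℚ.* ιₙ P) (trans steps (cong₂ ℚ._-_ (divide y′) (divide y))) ⟩
        (ιₙ (y′ ℕ.% P) ℚ.+ q′ ℚ.* ιₙ P) ℚ.- (ιₙ (y ℕ.% P) ℚ.+ q ℚ.* ιₙ P) ℚ.- (q′ ℚ.- q) ℚ.* ιₙ P
          ≡⟨ solve 5 (λ r′ r q′ q P → (r′ :+ q′ :* P) :- (r :+ q :* P) :- (q′ :- q) :* P := r′ :- r) refl (ιₙ (y′ ℕ.% P)) (ιₙ (y ℕ.% P)) q′ q (ιₙ P) ⟩
        ιₙ (y′ ℕ.% P) ℚ.- ιₙ (y ℕ.% P)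
          ∎
        where
        open +-*-Solver
        q′ = ιₙ (y′ ℕ./ P)
        q  = ιₙ (y ℕ./ P)

  -- S can be thinned out, keeping at least the proportion s of its elements, so that
  -- t u is within s of an integer for all differences t of the remaining ones.
  thin : ∀ S L → ∃ λ S′ →
    s ℚ.* ιₙ (count S 0 L) ℚ.≤ ιₙ (count S′ 0 L) ×
    (∀ k → S′ k ≡ true → S k ≡ true) ×
    (∀ k t → S′ k ≡ true → S′ (k ℕ.+ t) ≡ true → NearInteger s (ιₙ t ℚ.* u))
  thin S L = S′ , large , (λ k → proj₁ ∘ ∧-true) ,
    λ k t in₁ in₂ → return x k t (proj₂ (∧-true {S k} in₁)) (proj₂ (∧-true {S (k ℕ.+ t)} in₂))
    where
    rotation = averaging S (ℕ._* c) P A A≤P L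
    x = proj₁ rotation
    S′ : ℕ → Bool
    S′ k = S k ∧ arc P A (k ℕ.* c ℕ.+ x)
    open ℚ.≤-Reasoning
    large : s ℚ.* ιₙ (count S 0 L) ℚ.≤ ιₙ (count S′ 0 L)
    large = *-cancelʳ-≤ (ιₙ P) 0<P (begin
      s ℚ.* ιₙ (count S 0 L) ℚ.* ιₙ P           ≡⟨ solve 3 (λ s n P → s :* n :* P := s :* P :* n) refl s (ιₙ (count S 0 L)) (ιₙ P) ⟩
      s ℚ.* ιₙ P ℚ.* ιₙ (count S 0 L)           ≡⟨ cong (ℚ._* ιₙ (count S 0 L)) sP≡A ⟩
      ιₙ A ℚ.* ιₙ (count S 0 L)                 ≡⟨ ιₙ-* A (count S 0 L) ⟨
      ιₙ (A ℕ.* count S 0 L)                    ≤⟨ ιₙ-mono-≤ (proj₂ rotation) ⟩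
      ιₙ (P ℕ.* count S′ 0 L)                   ≡⟨ cong ιₙ (ℕ.*-comm P (count S′ 0 L)) ⟩
      ιₙ (count S′ 0 L ℕ.* P)                   ≡⟨ ιₙ-* (count S′ 0 L) P ⟩
      ιₙ (count S′ 0 L) ℚ.* ιₙ P                ∎)
      where open +-*-Solver

-- A set of times of density at least s ^ n all of whose differences t bring t u
-- back to within s of the lattice in every coordinate.
return-times : ∀ n (u : Vector ℚ n) s → 0ℚ ℚ.≤ s → s ℚ.≤ 1ℚ → ∀ L → ∃ λ S →
  s ^ᵠ n ℚ.* ιₙ L ℚ.≤ ιₙ (count S 0 L) ×
  (∀ k t → S k ≡ true → S (k ℕ.+ t) ≡ true → ∀ i → NearInteger s (ιₙ t ℚ.* u i))
return-times zero    u s 0≤s s≤1 L = (λ _ → true) ,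
  ℚ.≤-reflexive (trans (ℚ.*-identityˡ (ιₙ L)) (cong ιₙ (sym (trans (∑-const (λ _ → 1) 0 1 L λ _ _ → refl) (ℕ.*-identityʳ L))))) ,
  λ k t _ _ ()
return-times (suc n) u s 0≤s s≤1 L =
  let S , large , near = return-times n (tail u) s 0≤s s≤1 L
      S′ , large′ , S′⊆S , near′ = thin (head u) s 0≤s s≤1 S L
  in S′ ,
     ℚ.≤-trans (ℚ.≤-reflexive (ℚ.*-assoc s (s ^ᵠ n) (ιₙ L))) (ℚ.≤-trans (*-monoˡ-≤ s 0≤s large) large′) ,
     λ { k t in₁ in₂ zero    → near′ k t in₁ in₂
       ; k t in₁ in₂ (suc i) → near k t (S′⊆S k in₁) (S′⊆S (k ℕ.+ t) in₂) i }

-- Suppose that for each scale m = N - 1 - j with j in xs, no t between 2 ^ m and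
-- 2 ^ (m + 1) brings all coordinates of t u to within s of the integers.  The
-- density s ^ n of the return times is then at most 2 ^ - length xs.
few-scales : ∀ n (u : Vector ℚ n) s → 0ℚ ℚ.≤ s → s ℚ.≤ 1ℚ → ∀ N xs → Unique xs → All (ℕ._< N) xs →
  (∀ m j → m ℕ.+ suc j ≡ N → j ∈ xs → ∀ t → 2 ℕ.^ m ℕ.≤ t → t ℕ.≤ 2 ℕ.^ m ℕ.+ 2 ℕ.^ m →
    ¬ (∀ i → NearInteger s (ιₙ t ℚ.* u i))) →
  s ^ᵠ n ℚ.* 2^ (+ length xs) ℚ.≤ 1ℚ
few-scales n u s 0≤s s≤1 N xs xs! xs<N far =
  let S , large , near = return-times n u s 0≤s s≤1 (2 ℕ.^ N)
      E = λ m → does (N ℕ.∸ suc m ∈? xs)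
      avoid : ∀ m → m ℕ.< N → E m ≡ true → Avoids S (2 ℕ.^ m)
      avoid m m<N Em k t lo hi in₁ in₂ = far m (N ℕ.∸ suc m)
        (trans (ℕ.+-suc m (N ℕ.∸ suc m)) (ℕ.m+[n∸m]≡n m<N))
        (does-true (N ℕ.∸ suc m ∈? xs) Em) t lo hi (near k t in₁ in₂)
      dens : count S 0 (2 ℕ.^ N) ℕ.* 2 ℕ.^ length xs ℕ.≤ 2 ℕ.^ N
      dens = ℕ.≤-trans
        (ℕ.*-monoʳ-≤ (count S 0 (2 ℕ.^ N)) (ℕ.^-monoʳ-≤ 2 (length≤count N xs xs! xs<N)))
        (density S E N avoid N ℕ.≤-refl 0)
  in *-cancelʳ-≤ (ιₙ (2 ℕ.^ N)) (0<ιₙ (ℕ.m^n>0 2 N)) (begin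
    s ^ᵠ n ℚ.* 2^ (+ length xs) ℚ.* ιₙ (2 ℕ.^ N)              ≡⟨ solve 3 (λ a b c → a :* b :* c := a :* c :* b) refl (s ^ᵠ n) (2^ (+ length xs)) (ιₙ (2 ℕ.^ N)) ⟩
    s ^ᵠ n ℚ.* ιₙ (2 ℕ.^ N) ℚ.* 2^ (+ length xs)              ≤⟨ *-monoʳ-≤ (2^ (+ length xs)) (ℚ.<⇒≤ (0<2^ (+ length xs))) large ⟩
    ιₙ (count S 0 (2 ℕ.^ N)) ℚ.* 2^ (+ length xs)             ≡⟨ cong (ιₙ (count S 0 (2 ℕ.^ N)) ℚ.*_) (2^ιₙ (length xs)) ⟩
    ιₙ (count S 0 (2 ℕ.^ N)) ℚ.* ιₙ (2 ℕ.^ length xs)         ≡⟨ ιₙ-* (count S 0 (2 ℕ.^ N)) (2 ℕ.^ length xs) ⟨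
    ιₙ (count S 0 (2 ℕ.^ N) ℕ.* 2 ℕ.^ length xs)              ≤⟨ ιₙ-mono-≤ dens ⟩
    ιₙ (2 ℕ.^ N)                                              ≡⟨ ℚ.*-identityˡ (ιₙ (2 ℕ.^ N)) ⟨
    1ℚ ℚ.* ιₙ (2 ℕ.^ N)                                       ∎)
  where
  open ℚ.≤-Reasoning
  open +-*-Solver
  does-true : ∀ {a} {Q : Set a} (d : Dec Q) → does d ≡ true → Q
  does-true (yes q) _ = q

-- Nearest lattice points

p≤p+q : ∀ p {q} → 0ℚ ℚ.≤ q → p ℚ.≤ p ℚ.+ q
p≤p+q p {q} 0≤q = subst (ℚ._≤ p ℚ.+ q) (ℚ.+-identityʳ p) (ℚ.+-monoʳ-≤ p 0≤q)

+ℝ-mono-≤ : ∀ x x′ y y′ → x ≤ x′ → y ≤ y′ → x + y ≤ x′ + y′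
+ℝ-mono-≤ x x′ y y′ x≤x′ y≤y′ = ev-≤⇒≤ (x + y) (x′ + y′) λ ε 0<ε →
  ev-map (λ n (h₁ , h₂) → ℚ.≤-trans (ℚ.+-mono-≤ (ℚ.<⇒≤ h₁) (ℚ.<⇒≤ h₂))
           (ℚ.≤-reflexive (solve 3 (λ x y ε → (x :+ con ½ :* ε) :+ (y :+ con ½ :* ε) := (x :+ y) :+ ε) refl (seq x′ n) (seq y′ n) ε)))
    (ev-× (≤⇒ev-< x x′ x≤x′ (½ ℚ.* ε) (pos-* 0<½ 0<ε)) (≤⇒ev-< y y′ y≤y′ (½ ℚ.* ε) (pos-* 0<½ 0<ε)))
  where open +-*-Solver

∥∥₁-mono : ∀ {n} (v w : Vector ℝ n) → (∀ i → ∣ v i ∣ ≤ ∣ w i ∣) → ∥ v ∥₁ ≤ ∥ w ∥₁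
∥∥₁-mono {zero}  v w h = ≤-refl 0ℝ
∥∥₁-mono {suc n} v w h = +ℝ-mono-≤ ∣ head v ∣ ∣ head w ∣ ∥ tail v ∥₁ ∥ tail w ∥₁
  (h zero) (∥∥₁-mono (tail v) (tail w) λ i → h (suc i))

seq-∥∥₁-bound : ∀ {n} (v : Vector ℝ n) b m → (∀ i → ℚ.∣ seq (v i) m ∣ ℚ.≤ b) → seq ∥ v ∥₁ m ℚ.≤ ιₙ n ℚ.* b
seq-∥∥₁-bound {zero}  v b m h = ℚ.≤-reflexive (sym (trans (cong (ℚ._* b) ι0≡0) (ℚ.*-zeroˡ b)))
seq-∥∥₁-bound {suc n} v b m h = ℚ.≤-trans (ℚ.+-mono-≤ (h zero) (seq-∥∥₁-bound (tail v) b m λ i → h (suc i)))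
  (ℚ.≤-reflexive (trans (solve 2 (λ n b → b :+ n :* b := (con 1ℚ :+ n) :* b) refl (ιₙ n) b) (cong (ℚ._* b) (sym (ιₙ-suc n)))))
  where open +-*-Solver

seq-fromℤ : ∀ i n → seq (fromℤ i) n ≡ ι i
seq-fromℤ i n = sym (ι≡/1 i)

floor : ∀ a → ∃ λ k → ι k ℚ.≤ a × a ℚ.< 1ℚ ℚ.+ ι k
floor a = k
  , *-cancelʳ-≤ D 0<D (subst (ι k ℚ.* D ℚ.≤_) (sym division)
      (subst (ℚ._≤ ιₙ r ℚ.+ ι k ℚ.* D) (ℚ.+-identityˡ (ι k ℚ.* D)) (ℚ.+-monoˡ-≤ (ι k ℚ.* D) (0≤ιₙ r))))
  , *-cancelʳ-< D 0<D (begin-strict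
      a ℚ.* D                     ≡⟨ division ⟩
      ιₙ r ℚ.+ ι k ℚ.* D          <⟨ ℚ.+-monoˡ-< (ι k ℚ.* D) (ι-mono-< (ℤ.+<+ (ℤ.n%ℕd<d (ℚ.↥ a) (ℚ.↧ₙ a)))) ⟩
      D ℚ.+ ι k ℚ.* D             ≡⟨ solve 2 (λ d k → d :+ k :* d := (con 1ℚ :+ k) :* d) refl D (ι k) ⟩
      (1ℚ ℚ.+ ι k) ℚ.* D          ∎)
  where
  open ℚ.≤-Reasoning
  open +-*-Solver
  D = ιₙ (ℚ.↧ₙ a)
  0<D = 0<↧ a
  k = ℚ.↥ a ℤ./ℕ ℚ.↧ₙ a
  r = ℚ.↥ a ℤ.%ℕ ℚ.↧ₙ a
  division : a ℚ.* D ≡ ιₙ r ℚ.+ ι k ℚ.* D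
  division = trans (↥-↧ a) (trans (cong ι (ℤ.a≡a%ℕn+[a/ℕn]*n (ℚ.↥ a) (ℚ.↧ₙ a)))
    (trans (ι-+ (+ r) (k ℤ.* + (ℚ.↧ₙ a))) (cong (ιₙ r ℚ.+_) (ι-* k (+ (ℚ.↧ₙ a))))))

-- x lies within ½ of the integer m.
Rounds : ℝ → ℤ → Set
Rounds x m = ∀ ε → 0ℚ ℚ.< ε → Eventually λ n → ℚ.∣ seq x n ℚ.- ι m ∣ ℚ.≤ ½ ℚ.+ ε

¼ : ℚ
¼ = ½ ℚ.* ½

-- Which of two neighbouring integers is the nearer one is undecidable, hence the
-- double negation.
round : ∀ x → ¬ ¬ ∃ (Rounds x)
round x none = ≤-total-¬¬ x (fromℚ h) λ
  { (inj₁ x≤h) → none (k , λ ε 0<ε → ev-map (λ n → low ε (ℚ.<⇒≤ 0<ε) (seq x n)) (ev-× within (≤⇒ev-< x (fromℚ h) x≤h ε 0<ε)))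
  ; (inj₂ h≤x) → none (ℤ.suc k , λ ε 0<ε → ev-map (λ n → high ε (ℚ.<⇒≤ 0<ε) (seq x n)) (ev-× within (≤⇒ev-< (fromℚ h) x h≤x ε 0<ε))) }
  where
  open +-*-Solver
  open ℚ.≤-Reasoning
  N = proj₁ (cauchy x ¼ (pos-* 0<½ 0<½))
  k = proj₁ (floor (seq x N))
  k≤a = proj₁ (proj₂ (floor (seq x N)))
  a<1+k = proj₂ (proj₂ (floor (seq x N)))
  -- The midpoint between the two candidates k and k + 1.
  h = ι k ℚ.+ ½
  within : Eventually λ n → ℚ.∣ seq x n ℚ.- seq x N ∣ ℚ.< ¼
  within = N , λ n N≤n → proj₂ (cauchy x ¼ (pos-* 0<½ 0<½)) n N N≤n ℕ.≤-refl

  0≤¼ : 0ℚ ℚ.≤ ¼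
  0≤¼ = ℚ.<⇒≤ (pos-* 0<½ 0<½)

  low : ∀ ε → 0ℚ ℚ.≤ ε → ∀ y → ℚ.∣ y ℚ.- seq x N ∣ ℚ.< ¼ × y ℚ.< h ℚ.+ ε → ℚ.∣ y ℚ.- ι k ∣ ℚ.≤ ½ ℚ.+ ε
  low ε 0≤ε y (yx , y<h) = ∣p∣≤q
    (≤-diff (ℚ.<⇒≤ y<h) (solve 3 (λ k ε y → (k :+ con ½ :+ ε) :- y := (con ½ :+ ε) :- (y :- k)) refl (ι k) ε y))
    (begin
      ℚ.- (y ℚ.- ι k)      ≤⟨ ≤-diff (ℚ.≤-trans k≤a (ℚ.<⇒≤ (∣q-p∣<r⇒p<q+r (seq x N) y yx))) (solve 2 (λ k y → (y :+ con ¼) :- k := con ¼ :- (:- (y :- k))) refl (ι k) y) ⟩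
      ¼                    ≤⟨ ≤-diff 0≤¼ (solve 0 (con ¼ :- con 0ℚ := con ½ :- con ¼) refl) ⟩
      ½                    ≤⟨ p≤p+q ½ 0≤ε ⟩
      ½ ℚ.+ ε              ∎)

  high : ∀ ε → 0ℚ ℚ.≤ ε → ∀ y → ℚ.∣ y ℚ.- seq x N ∣ ℚ.< ¼ × h ℚ.< y ℚ.+ ε → ℚ.∣ y ℚ.- ι (ℤ.suc k) ∣ ℚ.≤ ½ ℚ.+ ε
  high ε 0≤ε y (yx , h<y) = subst (λ q → ℚ.∣ y ℚ.- q ∣ ℚ.≤ ½ ℚ.+ ε) (sym (trans (ι-+ (+ 1) k) (cong (ℚ._+ ι k) ι1≡1))) (∣p∣≤q
    (begin
      y ℚ.- (1ℚ ℚ.+ ι k)         ≤⟨ ≤-diff (ℚ.≤-trans (ℚ.<⇒≤ (∣p-q∣<r⇒p<q+r y (seq x N) yx)) (ℚ.+-monoˡ-≤ ¼ (ℚ.<⇒≤ a<1+k)))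
                                      (solve 2 (λ k y → (con 1ℚ :+ k :+ con ¼) :- y := con ¼ :- (y :- (con 1ℚ :+ k))) refl (ι k) y) ⟩
      ¼                          ≤⟨ ≤-diff 0≤¼ (solve 0 (con ¼ :- con 0ℚ := con ½ :- con ¼) refl) ⟩
      ½                          ≤⟨ p≤p+q ½ 0≤ε ⟩
      ½ ℚ.+ ε                    ∎)
    (≤-diff (ℚ.<⇒≤ h<y) (solve 3 (λ k ε y → (y :+ ε) :- (k :+ con ½) := (con ½ :+ ε) :- (:- (y :- (con 1ℚ :+ k)))) refl (ι k) ε y)))

1≤ι-ι : ∀ {m z} → m ℤ.< z → 1ℚ ℚ.≤ ι z ℚ.- ι m
1≤ι-ι {m} {z} m<z = ≤-diff (subst (ℚ._≤ ι z) (trans (ι-+ (+ 1) m) (cong (ℚ._+ ι m) ι1≡1)) (ι-mono-≤ (ℤ.i<j⇒suc[i]≤j m<z)))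
  (solve 2 (λ m z → z :- (con 1ℚ :+ m) := (z :- m) :- con 1ℚ) refl (ι m) (ι z))
  where open +-*-Solver

ι-apart : ∀ m z → m ≢ z → 1ℚ ℚ.≤ ℚ.∣ ι m ℚ.- ι z ∣
ι-apart m z m≢z with ℤ.<-cmp m z
... | tri< m<z _ _ = subst (1ℚ ℚ.≤_) (∣p-q∣≡∣q-p∣ (ι z) (ι m)) (ℚ.≤-trans (1≤ι-ι m<z) (p≤∣p∣ (ι z ℚ.- ι m)))
... | tri≈ _ m≡z _ = ⊥-elim (m≢z m≡z)
... | tri> _ _ z<m = ℚ.≤-trans (1≤ι-ι z<m) (p≤∣p∣ (ι m ℚ.- ι z))

rounds-nearest : ∀ x m → Rounds x m → ∀ z → ∣ x - fromℤ m ∣ ≤ ∣ x - fromℤ z ∣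
rounds-nearest x m rounds z with m ℤ.≟ z
... | yes refl = ≤-refl ∣ x - fromℤ m ∣
... | no  m≢z  = ev-≤⇒≤ ∣ x - fromℤ m ∣ ∣ x - fromℤ z ∣ λ ε 0<ε →
  ev-map (λ n close → subst₂ (λ p q → ℚ.∣ seq x n ℚ.- p ∣ ℚ.≤ ℚ.∣ seq x n ℚ.- q ∣ ℚ.+ ε) (ι≡/1 m) (ι≡/1 z) (nearer (seq x n) ε close))
    (rounds (½ ℚ.* ε) (pos-* 0<½ 0<ε))
  where
  open ℚ.≤-Reasoning
  open +-*-Solver
  nearer : ∀ y ε → ℚ.∣ y ℚ.- ι m ∣ ℚ.≤ ½ ℚ.+ ½ ℚ.* ε → ℚ.∣ y ℚ.- ι m ∣ ℚ.≤ ℚ.∣ y ℚ.- ι z ∣ ℚ.+ ε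
  nearer y ε close = ≤-diff (ℚ.+-mono-≤ (ℚ.+-mono-≤ close close) apart)
    (solve 3 (λ a b ε → (con ½ :+ con ½ :* ε :+ (con ½ :+ con ½ :* ε) :+ (a :+ b)) :- (a :+ a :+ con 1ℚ) := (b :+ ε) :- a)
      refl (ℚ.∣ y ℚ.- ι m ∣) (ℚ.∣ y ℚ.- ι z ∣) ε)
    where
    apart : 1ℚ ℚ.≤ ℚ.∣ y ℚ.- ι m ∣ ℚ.+ ℚ.∣ y ℚ.- ι z ∣
    apart = begin
      1ℚ                                            ≤⟨ ι-apart m z m≢z ⟩
      ℚ.∣ ι m ℚ.- ι z ∣                             ≡⟨ cong ℚ.∣_∣ (solve 3 (λ m z y → m :- z := (m :- y) :+ (y :- z)) refl (ι m) (ι z) y) ⟩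
      ℚ.∣ (ι m ℚ.- y) ℚ.+ (y ℚ.- ι z) ∣             ≤⟨ ℚ.∣p+q∣≤∣p∣+∣q∣ (ι m ℚ.- y) (y ℚ.- ι z) ⟩
      ℚ.∣ ι m ℚ.- y ∣ ℚ.+ ℚ.∣ y ℚ.- ι z ∣           ≡⟨ cong (ℚ._+ ℚ.∣ y ℚ.- ι z ∣) (∣p-q∣≡∣q-p∣ (ι m) y) ⟩
      ℚ.∣ y ℚ.- ι m ∣ ℚ.+ ℚ.∣ y ℚ.- ι z ∣           ∎

nearest-lattice-point : ∀ {n} (v : Vector ℝ n) →
  ¬ ¬ ∃ λ (z : Vector ℤ n) → ∀ (w : Vector ℤ n) i → ∣ v i - fromℤ (z i) ∣ ≤ ∣ v i - fromℤ (w i) ∣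
nearest-lattice-point {zero}  v none = none ((λ ()) , λ w ())
nearest-lattice-point {suc n} v none =
  round (head v) λ (m , rounds) → nearest-lattice-point (tail v) λ (z , nearest) →
  none (m ∷ᵛ z , λ { w zero    → rounds-nearest (head v) m rounds (head w)
                   ; w (suc i) → nearest (tail w) i })

-- The ℓ₁-distance to the lattice is attained, since the coordinates can be rounded
-- independently.
lattice-dist-exists : ∀ {n} (c : Vector ℝ n) τ → ¬ ¬ ∃ (IsLatticeDist c τ)
lattice-dist-exists c τ none = nearest-lattice-point (λ i → τ * c i) λ (z , nearest) →
  let d = ∥ (λ i → τ * c i - fromℤ (z i)) ∥₁
  in none (d , (z , ≤-refl d , ≤-refl d) ,
       λ w → ∥∥₁-mono (λ i → τ * c i - fromℤ (z i)) (λ i → τ * c i - fromℤ (w i)) (nearest w))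

-- Scales without a return

strict-upper-bound : ∀ xs → ∃ λ N → All (ℕ._< N) xs
strict-upper-bound []       = 0 , []
strict-upper-bound (x ∷ xs) =
  let N , xs<N = strict-upper-bound xs
  in suc x ℕ.⊔ N , ℕ.m≤m⊔n (suc x) N ∷ All.map (λ y<N → ℕ.≤-trans y<N (ℕ.m≤n⊔m (suc x) N)) xs<N

cauchyᵛ : ∀ {n} (c : Vector ℝ n) η → 0ℚ ℚ.< η →
  ∃ λ M → ∀ m → M ℕ.≤ m → ∀ i → ℚ.∣ seq (c i) m ℚ.- seq (c i) M ∣ ℚ.< η
cauchyᵛ c η 0<η = let M , h = go c in M , λ m M≤m → h m M M≤m ℕ.≤-refl
  where
  go : ∀ {n} (c : Vector ℝ n) → ∃ λ M → ∀ m m′ → M ℕ.≤ m → M ℕ.≤ m′ → ∀ i → ℚ.∣ seq (c i) m ℚ.- seq (c i) m′ ∣ ℚ.< η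
  go {zero}  c = 0 , λ m m′ _ _ ()
  go {suc n} c =
    let M₁ , h₁ = cauchy (head c) η 0<η
        M₂ , h₂ = go (tail c)
    in M₁ ℕ.⊔ M₂ , λ { m m′ M≤m M≤m′ zero    → h₁ m m′ (ℕ.m⊔n≤o⇒m≤o M₁ M₂ M≤m) (ℕ.m⊔n≤o⇒m≤o M₁ M₂ M≤m′)
                     ; m m′ M≤m M≤m′ (suc i) → h₂ m m′ (ℕ.m⊔n≤o⇒n≤o M₁ M₂ M≤m) (ℕ.m⊔n≤o⇒n≤o M₁ M₂ M≤m′) i }

-- For rational s with n s < ρ, the margin ε pays for replacing c by a rational
-- approximation: a time τ ≤ 1 that returns every coordinate of the approximation
-- to within s of the integers has D_c(τ) at most ρ.
module _ {n-1 : ℕ} (c : Vector ℝ (suc n-1)) (ρ : ℝ) (s ε : ℚ)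
  (0≤s : 0ℚ ℚ.≤ s) (s≤1 : s ℚ.≤ 1ℚ) (0<ε : 0ℚ ℚ.< ε)
  (ns<ρ : Eventually λ m → ιₙ (suc n-1) ℚ.* s ℚ.+ ε ℚ.≤ seq ρ m) where

  private
    n : ℕ
    n = suc n-1

    η : ℚ
    η = ε ℚ.* unit n-1

    approximation = cauchyᵛ c η (pos-* 0<ε (0<unit n-1))
    M = proj₁ approximation

    c̃ : Vector ℚ n
    c̃ i = seq (c i) M

    room : ιₙ n ℚ.* (s ℚ.+ η) ≡ ιₙ n ℚ.* s ℚ.+ ε
    room = trans (solve 4 (λ n s ε u → n :* (s :+ ε :* u) := n :* s :+ ε :* (n :* u)) refl (ιₙ n) s ε (unit n-1))
      (cong (ιₙ n ℚ.* s ℚ.+_) (trans (cong (ε ℚ.*_) (*-unit n-1)) (ℚ.*-identityʳ ε)))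
      where open +-*-Solver

    no-return : ∀ j τ → I j (fromℚ τ) → 0ℚ ℚ.≤ τ → τ ℚ.≤ 1ℚ → B c ρ j → ¬ (∀ i → NearInteger s (τ ℚ.* c̃ i))
    no-return j τ inI 0≤τ τ≤1 far near = lattice-dist-exists c (fromℚ τ) λ (d , isDist@(_ , d≤)) →
      let ε′ , 0<ε′ , ρ+ε′≤d = far (fromℚ τ) inI d isDist
          m , (ns+ε≤ρ , ρ+ε′≤d) , d<v+ε′ , v≤ =
            ev-∃ (ev-× (ev-× ns<ρ ρ+ε′≤d) (ev-× (≤⇒ev-< d ∥ v ∥₁ (d≤ z) ε′ 0<ε′) v-bound))
      in ℚ.<-irrefl refl (begin-strict
           seq d m                              <⟨ d<v+ε′ ⟩
           seq ∥ v ∥₁ m ℚ.+ ε′                  ≤⟨ ℚ.+-monoˡ-≤ ε′ v≤ ⟩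
           ιₙ n ℚ.* (s ℚ.+ η) ℚ.+ ε′            ≡⟨ cong (ℚ._+ ε′) room ⟩
           ιₙ n ℚ.* s ℚ.+ ε ℚ.+ ε′              ≤⟨ ℚ.+-monoˡ-≤ ε′ ns+ε≤ρ ⟩
           seq ρ m ℚ.+ ε′                       ≤⟨ ρ+ε′≤d ⟩
           seq d m                              ∎)
      where
      open ℚ.≤-Reasoning
      z : Vector ℤ n
      z i = proj₁ (near i)
      v : Vector ℝ n
      v i = fromℚ τ * c i - fromℤ (z i)
      coordinate : ∀ m → M ℕ.≤ m → ∀ i → ℚ.∣ seq (v i) m ∣ ℚ.≤ s ℚ.+ η
      coordinate m M≤m i = begin
        ℚ.∣ τ ℚ.* y ℚ.- seq (fromℤ (z i)) m ∣                       ≡⟨ cong (λ p → ℚ.∣ τ ℚ.* y ℚ.- p ∣) (seq-fromℤ (z i) m) ⟩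
        ℚ.∣ τ ℚ.* y ℚ.- ι (z i) ∣                                   ≡⟨ cong ℚ.∣_∣ (solve 4 (λ τ y y′ z → τ :* y :- z := (τ :* y′ :- z) :+ τ :* (y :- y′)) refl τ y (c̃ i) (ι (z i))) ⟩
        ℚ.∣ (τ ℚ.* c̃ i ℚ.- ι (z i)) ℚ.+ τ ℚ.* (y ℚ.- c̃ i) ∣         ≤⟨ ℚ.∣p+q∣≤∣p∣+∣q∣ (τ ℚ.* c̃ i ℚ.- ι (z i)) (τ ℚ.* (y ℚ.- c̃ i)) ⟩
        ℚ.∣ τ ℚ.* c̃ i ℚ.- ι (z i) ∣ ℚ.+ ℚ.∣ τ ℚ.* (y ℚ.- c̃ i) ∣     ≤⟨ ℚ.+-mono-≤ (proj₂ (near i)) small ⟩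
        s ℚ.+ η                                                     ∎
        where
        open +-*-Solver
        y = seq (c i) m
        small : ℚ.∣ τ ℚ.* (y ℚ.- c̃ i) ∣ ℚ.≤ η
        small = begin
          ℚ.∣ τ ℚ.* (y ℚ.- c̃ i) ∣              ≡⟨ ℚ.∣p*q∣≡∣p∣*∣q∣ τ (y ℚ.- c̃ i) ⟩
          ℚ.∣ τ ∣ ℚ.* ℚ.∣ y ℚ.- c̃ i ∣          ≡⟨ cong (ℚ._* ℚ.∣ y ℚ.- c̃ i ∣) (ℚ.0≤p⇒∣p∣≡p 0≤τ) ⟩
          τ ℚ.* ℚ.∣ y ℚ.- c̃ i ∣                ≤⟨ *-monoʳ-≤ ℚ.∣ y ℚ.- c̃ i ∣ (ℚ.0≤∣p∣ (y ℚ.- c̃ i)) τ≤1 ⟩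
          1ℚ ℚ.* ℚ.∣ y ℚ.- c̃ i ∣               ≡⟨ ℚ.*-identityˡ ℚ.∣ y ℚ.- c̃ i ∣ ⟩
          ℚ.∣ y ℚ.- c̃ i ∣                      ≤⟨ ℚ.<⇒≤ (proj₂ approximation m M≤m i) ⟩
          η                                    ∎
      v-bound : Eventually λ m → seq ∥ v ∥₁ m ℚ.≤ ιₙ n ℚ.* (s ℚ.+ η)
      v-bound = M , λ m M≤m → seq-∥∥₁-bound v (s ℚ.+ η) m (coordinate m M≤m)

  few-scales-B : ∀ xs → Unique xs → All (B c ρ) xs → s ^ᵠ n ℚ.* 2^ (+ length xs) ℚ.≤ 1ℚ
  few-scales-B xs xs! xs⊆B = few-scales n u s 0≤s s≤1 N xs xs! xs<N far
    where
    N = proj₁ (strict-upper-bound xs)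
    xs<N = proj₂ (strict-upper-bound xs)
    -- Time is discretised in steps of 2 ^ - N.
    step : ℚ
    step = 2^ (ℤ.- (+ N))
    u : Vector ℚ n
    u i = step ℚ.* c̃ i

    far : ∀ m j → m ℕ.+ suc j ≡ N → j ∈ xs → ∀ t → 2 ℕ.^ m ℕ.≤ t → t ℕ.≤ 2 ℕ.^ m ℕ.+ 2 ℕ.^ m →
      ¬ (∀ i → NearInteger s (ιₙ t ℚ.* u i))
    far m j eq j∈xs t lo hi near = no-return j τ
      (fromℚ-mono-≤ lower-end , fromℚ-mono-≤ upper-end) 0≤τ (ℚ.≤-trans upper-end (2^-mono-≤ (-n≤0 j)))
      (All.lookup xs⊆B j∈xs)
      λ i → subst (NearInteger s) (sym (ℚ.*-assoc (ιₙ t) step (c̃ i))) (near i)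
      where
      open ℚ.≤-Reasoning
      τ : ℚ
      τ = ιₙ t ℚ.* step
      0≤step = ℚ.<⇒≤ (0<2^ (ℤ.- (+ N)))
      0≤τ : 0ℚ ℚ.≤ τ
      0≤τ = *-nonNeg (0≤ιₙ t) 0≤step
      -n≤0 : ∀ n → ℤ.- (+ n) ℤ.≤ + 0
      -n≤0 zero    = ℤ.≤-refl
      -n≤0 (suc n) = ℤ.-≤+
      scale : ∀ m j → m ℕ.+ j ≡ N → 2^ (ℤ.- (+ j)) ≡ ιₙ (2 ℕ.^ m) ℚ.* step
      scale m j eq = trans (cong 2^ exponents) (trans (2^-+ (+ m) (ℤ.- (+ N))) (cong (ℚ._* step) (2^ιₙ m)))
        where
        exponents : ℤ.- (+ j) ≡ + m ℤ.- + N
        exponents = trans (solve 2 (λ m j → :- j := m :- (m :+ j)) refl (+ m) (+ j))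
          (cong (λ e → + m ℤ.- e) (trans (sym (ℤ.pos-+ m j)) (cong +_ eq)))
          where open ℤ-Solver
      lower-end : 2^ (ℤ.- (+ suc j)) ℚ.≤ τ
      lower-end = begin
        2^ (ℤ.- (+ suc j))             ≡⟨ scale m (suc j) eq ⟩
        ιₙ (2 ℕ.^ m) ℚ.* step          ≤⟨ *-monoʳ-≤ step 0≤step (ιₙ-mono-≤ lo) ⟩
        τ                              ∎
      upper-end : τ ℚ.≤ 2^ (ℤ.- (+ j))
      upper-end = begin
        τ                                        ≤⟨ *-monoʳ-≤ step 0≤step (ιₙ-mono-≤ hi) ⟩
        ιₙ (2 ℕ.^ m ℕ.+ 2 ℕ.^ m) ℚ.* step        ≡⟨ cong (λ k → ιₙ k ℚ.* step) (2^suc m) ⟨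
        ιₙ (2 ℕ.^ suc m) ℚ.* step                ≡⟨ scale (suc m) j (trans (sym (ℕ.+-suc m j)) eq) ⟨
        2^ (ℤ.- (+ j))                           ∎

-- Finiteness from a bound on the cardinality

bounded-length⇒Finite : ∀ {P : ℕ → Set} K → (∀ xs → Unique xs → All P xs → length xs ℕ.≤ K) → Finite P
bounded-length⇒Finite {P} K bound infinite = long (suc K) λ (xs , xs! , xs⊆P , len) →
  ℕ.<-irrefl refl (subst (ℕ._≤ K) len (bound xs xs! xs⊆P))
  where
  -- A list that does not enumerate P can be prolonged.
  long : ∀ m → ¬ ¬ ∃ λ xs → Unique xs × All P xs × length xs ≡ m
  long zero    none = none ([] , [] , [] , refl)
  long (suc m) none = long m λ (xs , xs! , xs⊆P , len) →
    infinite (xs , xs! , λ j → mk⇔ (All.lookup xs⊆P) (λ Pj → decidable-stable (j ∈? xs) λ j∉xs →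
      none (j ∷ xs , All.tabulate (λ i∈xs j≡i → j∉xs (subst (_∈ xs) (sym j≡i) i∈xs)) ∷ xs! , Pj ∷ xs⊆P , cong suc len)))

CardAtMost⇒Finite : ∀ {P : ℕ → Set} b → CardAtMost P b → Finite P
CardAtMost⇒Finite {P} b card =
  let K , _ , b≤K = bounded b
      k , K<k = archimedean K
  in bounded-length⇒Finite k λ xs xs! xs⊆P → ℕ.≮⇒≥ λ k<len → card xs xs! xs⊆P
       (ιₙ (length xs) ℚ.- K
       , <-diff (ℚ.<-≤-trans K<k (ιₙ-mono-≤ (ℕ.<⇒≤ k<len))) (solve 2 (λ l K → l :- K := (l :- K) :- con 0ℚ) refl (ιₙ (length xs)) K)
       , ev-map (λ n ∣b∣≤K → subst (seq b n ℚ.+ (ιₙ (length xs) ℚ.- K) ℚ.≤_) (ι≡/1 (+ length xs))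
           (≤-diff (ℚ.≤-trans (p≤∣p∣ (seq b n)) ∣b∣≤K)
             (solve 3 (λ b K l → K :- b := l :- (b :+ (l :- K))) refl (seq b n) K (ιₙ (length xs))))) b≤K)
  where open +-*-Solver

-- The cardinality bound

recip-antimono : ∀ {p q} (0<p : 0ℚ ℚ.< p) (0<q : 0ℚ ℚ.< q) → p ℚ.≤ q → recip q 0<q ℚ.≤ recip p 0<p
recip-antimono {p} {q} 0<p 0<q p≤q = begin
  q⁻¹                          ≡⟨ ℚ.*-identityʳ q⁻¹ ⟨
  q⁻¹ ℚ.* 1ℚ                   ≡⟨ cong (q⁻¹ ℚ.*_) (*-recip p 0<p) ⟨
  q⁻¹ ℚ.* (p ℚ.* p⁻¹)          ≤⟨ *-monoˡ-≤ q⁻¹ (ℚ.<⇒≤ (recip-pos q 0<q)) (*-monoʳ-≤ p⁻¹ (ℚ.<⇒≤ (recip-pos p 0<p)) p≤q) ⟩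
  q⁻¹ ℚ.* (q ℚ.* p⁻¹)          ≡⟨ solve 3 (λ a b c → a :* (b :* c) := b :* a :* c) refl q⁻¹ q p⁻¹ ⟩
  q ℚ.* q⁻¹ ℚ.* p⁻¹            ≡⟨ cong (ℚ._* p⁻¹) (*-recip q 0<q) ⟩
  1ℚ ℚ.* p⁻¹                   ≡⟨ ℚ.*-identityˡ p⁻¹ ⟩
  p⁻¹                          ∎
  where
  open ℚ.≤-Reasoning
  open +-*-Solver
  p⁻¹ = recip p 0<p
  q⁻¹ = recip q 0<q

module Bound {n-1 : ℕ} (c : Vector ℝ (suc n-1)) (ρ : ℝ) (0<ρ : 0ℝ < ρ) (ρ≤n : ρ ≤ fromℕ (suc n-1)) where

  private
    n : ℕ
    n = suc n-1

    δ = proj₁ 0<ρ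
    0<δ = proj₁ (proj₂ 0<ρ)

    δ≤ρ : Eventually λ m → δ ℚ.≤ seq ρ m
    δ≤ρ = ev-map (λ m → subst (ℚ._≤ seq ρ m) (ℚ.+-identityˡ δ)) (proj₂ (proj₂ 0<ρ))

  n/ρ : ℝ
  n/ρ = fromℕ n * reciprocal ρ 0<ρ

  private
    0<δ⊔ρ : ∀ m → 0ℚ ℚ.< δ ℚ.⊔ seq ρ m
    0<δ⊔ρ m = ℚ.<-≤-trans 0<δ (ℚ.p≤p⊔q δ (seq ρ m))

    seq-n/ρ : ∀ m → seq n/ρ m ≡ ιₙ n ℚ.* recip (δ ℚ.⊔ seq ρ m) (0<δ⊔ρ m)
    seq-n/ρ m = cong (ℚ._* recip (δ ℚ.⊔ seq ρ m) (0<δ⊔ρ m)) (sym (ι≡/1 (+ n)))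

  0<n/ρ : 0ℝ < n/ρ
  0<n/ρ =
    let K , 0<K , ∣ρ∣≤K = bounded ρ
        0<δ+K = ℚ.+-mono-< 0<δ 0<K
        r = recip (δ ℚ.+ K) 0<δ+K
    in r , recip-pos (δ ℚ.+ K) 0<δ+K , ev-map (λ m ∣ρₘ∣≤K → begin
      0ℚ ℚ.+ r                                            ≡⟨ ℚ.+-identityˡ r ⟩
      r                                                   ≤⟨ recip-antimono (0<δ⊔ρ m) 0<δ+K
                                                               (ℚ.⊔-lub (p≤p+q δ (ℚ.<⇒≤ 0<K)) (ℚ.≤-trans (p≤∣p∣ (seq ρ m)) (ℚ.≤-trans ∣ρₘ∣≤K
                                                                 (subst (K ℚ.≤_) (ℚ.+-comm K δ) (p≤p+q K (ℚ.<⇒≤ 0<δ)))))) ⟩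
      recip (δ ℚ.⊔ seq ρ m) (0<δ⊔ρ m)                     ≡⟨ ℚ.*-identityˡ _ ⟨
      1ℚ ℚ.* recip (δ ℚ.⊔ seq ρ m) (0<δ⊔ρ m)              ≤⟨ *-monoʳ-≤ _ (ℚ.<⇒≤ (recip-pos _ (0<δ⊔ρ m))) (subst (ℚ._≤ ιₙ n) ι1≡1 (ιₙ-mono-≤ (ℕ.s≤s ℕ.z≤n))) ⟩
      ιₙ n ℚ.* recip (δ ℚ.⊔ seq ρ m) (0<δ⊔ρ m)            ≡⟨ seq-n/ρ m ⟨
      seq n/ρ m                                           ∎) ∣ρ∣≤K
    where open ℚ.≤-Reasoning

  open Logarithm n/ρ 0<n/ρ

  private
    -- ρₘ / n times the m-th term of n / ρ; the truncation of ρ at δ is inactive here.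
    inverse : ∀ m → δ ℚ.≤ seq ρ m → seq ρ m ℚ.* unit n-1 ℚ.* seq n/ρ m ≡ 1ℚ
    inverse m δ≤ρₘ = begin
      ρₘ ℚ.* unit n-1 ℚ.* seq n/ρ m                ≡⟨ cong (ρₘ ℚ.* unit n-1 ℚ.*_) (seq-n/ρ m) ⟩
      ρₘ ℚ.* unit n-1 ℚ.* (ιₙ n ℚ.* r)             ≡⟨ cong (λ p → p ℚ.* unit n-1 ℚ.* (ιₙ n ℚ.* r)) (ℚ.p≤q⇒p⊔q≡q δ≤ρₘ) ⟨
      t ℚ.* unit n-1 ℚ.* (ιₙ n ℚ.* r)              ≡⟨ solve 4 (λ t u n r → t :* u :* (n :* r) := (n :* u) :* (t :* r)) refl t (unit n-1) (ιₙ n) r ⟩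
      ιₙ n ℚ.* unit n-1 ℚ.* (t ℚ.* r)              ≡⟨ cong₂ ℚ._*_ (*-unit n-1) (*-recip t (0<δ⊔ρ m)) ⟩
      1ℚ ℚ.* 1ℚ                                    ≡⟨⟩
      1ℚ                                           ∎
      where
      open ≡-Reasoning
      open +-*-Solver
      ρₘ = seq ρ m
      t = δ ℚ.⊔ ρₘ
      r = recip t (0<δ⊔ρ m)

  -- If n log₂ (n / ρ) < k = length xs, some rational p / q < k / n lies above the
  -- logarithm, that is (n / ρ) ^ q < 2 ^ p; as p n < k q are integers, the q-th power
  -- of 2 ^ k (ρ / n) ^ n is at least 2.  Replacing ρ / n by a slightly smaller
  -- rational s loses less than a factor of 2, so that 2 ^ k s ^ n > 1.
  card : CardAtMost (B c ρ) (fromℕ n * log₂)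
  card xs xs! xs⊆B (ε , 0<ε , nL+ε≤k) = contradiction
    where
    open ℚ.≤-Reasoning
    open +-*-Solver

    k : ℕ
    k = length xs

    ½ε = ½ ℚ.* ε

    r : ℚ
    r = (ιₙ k ℚ.- ½ε) ℚ.* unit n-1

    0<½ε/n : 0ℚ ℚ.< ½ε ℚ.* unit n-1
    0<½ε/n = pos-* (pos-* 0<½ 0<ε) (0<unit n-1)

    L<r : log₂ < fromℚ r
    L<r = ½ε ℚ.* unit n-1 , 0<½ε/n , ev-map step nL+ε≤k
      where
      step : ∀ m → seq (fromℕ n * log₂) m ℚ.+ ε ℚ.≤ seq (fromℕ k) m → seq log₂ m ℚ.+ ½ε ℚ.* unit n-1 ℚ.≤ r
      step m h = begin
        l ℚ.+ ½ε ℚ.* unit n-1                                 ≡⟨ cong (ℚ._+ ½ε ℚ.* unit n-1) (trans (sym (ℚ.*-identityʳ l)) (cong (l ℚ.*_) (sym (*-unit n-1)))) ⟩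
        l ℚ.* (ιₙ n ℚ.* unit n-1) ℚ.+ ½ε ℚ.* unit n-1         ≡⟨ solve 4 (λ l n u h → l :* (n :* u) :+ h :* u := (n :* l :+ h) :* u) refl l (ιₙ n) (unit n-1) ½ε ⟩
        (ιₙ n ℚ.* l ℚ.+ ½ε) ℚ.* unit n-1                      ≤⟨ *-monoʳ-≤ {ιₙ n ℚ.* l ℚ.+ ½ε} {ιₙ k ℚ.- ½ε} (unit n-1) (ℚ.<⇒≤ (0<unit n-1)) (≤-diff h′ (solve 3 (λ a k ε → k :- (a :+ ε) := (k :- con ½ :* ε) :- (a :+ con ½ :* ε)) refl (ιₙ n ℚ.* l) (ιₙ k) ε)) ⟩
        (ιₙ k ℚ.- ½ε) ℚ.* unit n-1                            ∎
        where
        l = seq log₂ m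
        h′ : ιₙ n ℚ.* l ℚ.+ ε ℚ.≤ ιₙ k
        h′ = subst₂ (λ a b → a ℚ.* l ℚ.+ ε ℚ.≤ b) (sym (ι≡/1 (+ n))) (sym (ι≡/1 (+ k))) h

    p : ℤ
    p = ℚ.↥ r
    q : ℕ
    q = ℚ.↧ₙ r

    pn<kq : p ℤ.* + n ℤ.< + k ℤ.* + q
    pn<kq = cross-< p (+ k) (ℚ.denominator-1 r) n-1 (subst (ℚ._< ιₙ k ℚ.* unit n-1) (≡-fraction r)
      (<-diff 0<½ε/n (solve 3 (λ k h u → h :* u :- con 0ℚ := k :* u :- (k :- h) :* u) refl (ιₙ k) ½ε (unit n-1))))

    x^q<2^p : Eventually λ m → seq n/ρ m ^ᵠ q ℚ.< 2^ p
    x^q<2^p = let ε₁ , 0<ε₁ , h = proj₂ isLog₂ r L<r in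
      ev-map (λ m → below m ε₁ 0<ε₁) h
      where
      below : ∀ m ε₁ → 0ℚ ℚ.< ε₁ → seq (n/ρ ^ q) m ℚ.+ ε₁ ℚ.≤ 2^ p → seq n/ρ m ^ᵠ q ℚ.< 2^ p
      below m ε₁ 0<ε₁ h = subst (ℚ._< 2^ p) (seq-^ n/ρ q m) (ℚ.<-≤-trans
        (subst (ℚ._< seq (n/ρ ^ q) m ℚ.+ ε₁) (ℚ.+-identityʳ _) (ℚ.+-monoʳ-< (seq (n/ρ ^ q) m) 0<ε₁)) h)

    -- At the exponent T = n q, the factor shrink T between ρ / n and s costs less than a
    -- factor of 2; it leaves the margin γ between n s and ρ.
    T : ℕ
    T = n ℕ.* q
    γ : ℚ
    γ = ½ ℚ.* (δ ℚ.* slack T)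
    0<γ : 0ℚ ℚ.< γ
    0<γ = pos-* 0<½ (pos-* 0<δ (0<slack T))

    near : Eventually λ m → Eventually λ m′ → ℚ.∣ seq ρ m ℚ.- seq ρ m′ ∣ ℚ.< γ
    near = let N , h = cauchy ρ γ 0<γ in N , λ m N≤m → N , λ m′ N≤m′ → h m m′ N≤m N≤m′

    0<n·slack : 0ℚ ℚ.< ιₙ n ℚ.* slack T
    0<n·slack = pos-* (0<ιₙ (ℕ.s≤s ℕ.z≤n)) (0<slack T)

    -- An index at which ρ has settled up to γ and exceeds n by little, if at all.
    late = ev-∃ (ev-× (ev-× δ≤ρ x^q<2^p) (ev-× (≤⇒ev-< ρ (fromℕ n) ρ≤n (ιₙ n ℚ.* slack T) 0<n·slack) near))

    m : ℕ
    m = proj₁ late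
    δ≤ρₘ : δ ℚ.≤ seq ρ m
    δ≤ρₘ = proj₁ (proj₁ (proj₂ late))
    xₘ^q<2^p : seq n/ρ m ^ᵠ q ℚ.< 2^ p
    xₘ^q<2^p = proj₂ (proj₁ (proj₂ late))
    ρₘ<n : seq ρ m ℚ.< ιₙ n ℚ.+ ιₙ n ℚ.* slack T
    ρₘ<n = subst (λ a → seq ρ m ℚ.< a ℚ.+ ιₙ n ℚ.* slack T) (sym (ι≡/1 (+ n))) (proj₁ (proj₂ (proj₂ late)))
    nearₘ : Eventually λ m′ → ℚ.∣ seq ρ m ℚ.- seq ρ m′ ∣ ℚ.< γ
    nearₘ = proj₂ (proj₂ (proj₂ late))

    x y s : ℚ
    x = seq n/ρ m
    y = seq ρ m ℚ.* unit n-1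
    s = y ℚ.* shrink T

    0<y : 0ℚ ℚ.< y
    0<y = pos-* (ℚ.<-≤-trans 0<δ δ≤ρₘ) (0<unit n-1)

    0≤s : 0ℚ ℚ.≤ s
    0≤s = ℚ.<⇒≤ (pos-* 0<y (0<shrink T))

    ny≡ρₘ : ιₙ n ℚ.* y ≡ seq ρ m
    ny≡ρₘ = trans (solve 3 (λ n ρ u → n :* (ρ :* u) := (n :* u) :* ρ) refl (ιₙ n) (seq ρ m) (unit n-1))
      (trans (cong (ℚ._* seq ρ m) (*-unit n-1)) (ℚ.*-identityˡ (seq ρ m)))

    s≤1 : s ℚ.≤ 1ℚ
    s≤1 = begin
      y ℚ.* shrink T                         ≤⟨ *-monoʳ-≤ (shrink T) (ℚ.<⇒≤ (0<shrink T)) y≤1+slack ⟩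
      (1ℚ ℚ.+ slack T) ℚ.* shrink T          ≤⟨ ≤-diff (*-nonNeg (ℚ.<⇒≤ (0<slack T)) (ℚ.<⇒≤ (0<slack T))) (solve 1 (λ σ → σ :* σ :- con 0ℚ := con 1ℚ :- (con 1ℚ :+ σ) :* (con 1ℚ :- σ)) refl (slack T)) ⟩
      1ℚ                                     ∎
      where
      y≤1+slack : y ℚ.≤ 1ℚ ℚ.+ slack T
      y≤1+slack = *-cancelʳ-≤ (ιₙ n) (0<ιₙ (ℕ.s≤s ℕ.z≤n)) (begin
        y ℚ.* ιₙ n                             ≡⟨ trans (ℚ.*-comm y (ιₙ n)) ny≡ρₘ ⟩
        seq ρ m                                ≤⟨ ℚ.<⇒≤ ρₘ<n ⟩
        ιₙ n ℚ.+ ιₙ n ℚ.* slack T              ≡⟨ solve 2 (λ n σ → n :+ n :* σ := (con 1ℚ :+ σ) :* n) refl (ιₙ n) (slack T) ⟩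
        (1ℚ ℚ.+ slack T) ℚ.* ιₙ n              ∎)

    ns<ρ : Eventually λ m′ → ιₙ n ℚ.* s ℚ.+ γ ℚ.≤ seq ρ m′
    ns<ρ = ev-map step nearₘ
      where
      step : ∀ m′ → ℚ.∣ seq ρ m ℚ.- seq ρ m′ ∣ ℚ.< γ → ιₙ n ℚ.* s ℚ.+ γ ℚ.≤ seq ρ m′
      step m′ h = begin
        ιₙ n ℚ.* s ℚ.+ γ                                       ≡⟨ cong (ℚ._+ γ) (trans (sym (ℚ.*-assoc (ιₙ n) y (shrink T))) (cong (ℚ._* shrink T) ny≡ρₘ)) ⟩
        seq ρ m ℚ.* shrink T ℚ.+ γ                             ≤⟨ ≤-diff (*-monoʳ-≤ (slack T) (ℚ.<⇒≤ (0<slack T)) δ≤ρₘ)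
                                                                    (solve 3 (λ ρ δ σ → ρ :* σ :- δ :* σ := (ρ :- con ½ :* (δ :* σ)) :- (ρ :* (con 1ℚ :- σ) :+ con ½ :* (δ :* σ))) refl (seq ρ m) δ (slack T)) ⟩
        seq ρ m ℚ.- γ                                          ≤⟨ ≤-diff (ℚ.<⇒≤ (∣p-q∣<r⇒p<q+r (seq ρ m) (seq ρ m′) h))
                                                                    (solve 3 (λ ρ ρ′ γ → (ρ′ :+ γ) :- ρ := ρ′ :- (ρ :- γ)) refl (seq ρ m) (seq ρ m′) γ) ⟩
        seq ρ m′                                               ∎

    few : s ^ᵠ n ℚ.* 2^ (+ k) ℚ.≤ 1ℚ
    few = few-scales-B c ρ s γ 0≤s s≤1 0<γ ns<ρ xs xs! xs⊆B

    1≤y^q·2^p : 1ℚ ℚ.≤ y ^ᵠ q ℚ.* 2^ p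
    1≤y^q·2^p = begin
      1ℚ                           ≡⟨ 1^ q ⟨
      1ℚ ^ᵠ q                      ≡⟨ cong (_^ᵠ q) (inverse m δ≤ρₘ) ⟨
      (y ℚ.* x) ^ᵠ q               ≡⟨ ^ᵠ-distrib-* y x q ⟩
      y ^ᵠ q ℚ.* x ^ᵠ q            ≤⟨ *-monoˡ-≤ (y ^ᵠ q) (0≤^ (ℚ.<⇒≤ 0<y) q) (ℚ.<⇒≤ xₘ^q<2^p) ⟩
      y ^ᵠ q ℚ.* 2^ p              ∎

    2≤y^T·2^kq : 2ℚ ℚ.≤ y ^ᵠ T ℚ.* 2^ (+ k ℤ.* + q)
    2≤y^T·2^kq = begin
      2ℚ ℚ.* 1ℚ                                          ≡⟨ cong (2ℚ ℚ.*_) (1^ n) ⟨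
      2ℚ ℚ.* 1ℚ ^ᵠ n                                     ≤⟨ *-monoˡ-≤ 2ℚ (ℚ.<⇒≤ (ℚ.positive⁻¹ 2ℚ)) (^-mono-≤ (ℚ.<⇒≤ (ℚ.positive⁻¹ 1ℚ)) 1≤y^q·2^p n) ⟩
      2ℚ ℚ.* (y ^ᵠ q ℚ.* 2^ p) ^ᵠ n                      ≡⟨ cong (2ℚ ℚ.*_) (trans (^ᵠ-distrib-* (y ^ᵠ q) (2^ p) n) (cong₂ ℚ._*_ (trans (^-swap y q n) (^ᵠ-assocʳ y n q)) (2^-^ p n))) ⟩
      2ℚ ℚ.* (y ^ᵠ T ℚ.* 2^ (p ℤ.* + n))                 ≡⟨ solve 2 (λ a b → con 2ℚ :* (a :* b) := a :* (con 2ℚ :* b)) refl (y ^ᵠ T) (2^ (p ℤ.* + n)) ⟩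
      y ^ᵠ T ℚ.* (2ℚ ℚ.* 2^ (p ℤ.* + n))                 ≤⟨ *-monoˡ-≤ (y ^ᵠ T) (0≤^ (ℚ.<⇒≤ 0<y) T) (2^-double pn<kq) ⟩
      y ^ᵠ T ℚ.* 2^ (+ k ℤ.* + q)                        ∎

    contradiction : ⊥
    contradiction = ℚ.<-irrefl refl (begin-strict
      2ℚ                                                 ≤⟨ 2≤y^T·2^kq ⟩
      y ^ᵠ T ℚ.* 2^ (+ k ℤ.* + q)                        <⟨ ℚ.*-monoˡ-<-pos (2^ (+ k ℤ.* + q)) {{ℚ.positive (0<2^ (+ k ℤ.* + q))}} (shrink-^ T 0<y ℚ.≤-refl) ⟩
      2ℚ ℚ.* s ^ᵠ T ℚ.* 2^ (+ k ℤ.* + q)                 ≡⟨ ℚ.*-assoc 2ℚ (s ^ᵠ T) (2^ (+ k ℤ.* + q)) ⟩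
      2ℚ ℚ.* (s ^ᵠ T ℚ.* 2^ (+ k ℤ.* + q))               ≡⟨ cong (2ℚ ℚ.*_) (trans (cong₂ ℚ._*_ (sym (^ᵠ-assocʳ s n q)) (sym (2^-^ (+ k) q))) (sym (^ᵠ-distrib-* (s ^ᵠ n) (2^ (+ k)) q))) ⟩
      2ℚ ℚ.* (s ^ᵠ n ℚ.* 2^ (+ k)) ^ᵠ q                  ≤⟨ *-monoˡ-≤ 2ℚ (ℚ.<⇒≤ (ℚ.positive⁻¹ 2ℚ)) (^-mono-≤ (*-nonNeg (0≤^ 0≤s n) (ℚ.<⇒≤ (0<2^ (+ k)))) few q) ⟩
      2ℚ ℚ.* 1ℚ ^ᵠ q                                     ≡⟨ cong (2ℚ ℚ.*_) (1^ q) ⟩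
      2ℚ                                                 ∎)

  solution : Σ ℝ λ L → IsLog₂ n/ρ L × CardAtMost (B c ρ) (fromℕ n * L) × Finite (B c ρ)
  solution = log₂ , isLog₂ , card , CardAtMost⇒Finite (fromℕ n * log₂) card

theorem5 : (n : ℕ) → 1 ℕ.≤ n → (c : Vector ℝ n) (ρ : ℝ) (0<ρ : 0ℝ < ρ) → ρ ≤ fromℕ n →
    Σ ℝ λ L → IsLog₂ (fromℕ n * reciprocal ρ 0<ρ) L ×
    CardAtMost (B c ρ) (fromℕ n * L) ×
    Finite (B c ρ)
theorem5 (suc n-1) 1≤n c ρ 0<ρ ρ≤n = Bound.solution c ρ 0<ρ ρ≤n
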